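{- Let $Q_n$ be the $n$-dimensional hypercube graph. The system over $\mathbb F_2$ requiring that every $4$-cycle of $Q_n$ be unbalanced, i.e. $s\cdot\chi_C=1$ for every $4$-cycle $C$, is consistent, and every solution $\sigma$ satisfies $A_\sigma^2=nI$; consequently $\rho(A_\sigma)=\sqrt n$ for the entire affine solution family.
   Context: A signing of a graph with edge set $E$ is $\sigma\in\{\pm1\}^E$, encoded by $s\in\mathbb F_2^E$ with $\sigma_e=(-1)^{s_e}$; $A_\sigma$ is the signed adjacency matrix with $uv$ entry $\sigma_{uv}$ if $uv\in E$ and $0$ otherwise; $\rho(A_\sigma)=\max_i|\lambda_i(A_\sigma)|$. For a cycle $C$, $\chi_C\in\mathbb F_2^E$ is the indicator vector of its edge set; $C$ is unbalanced if $s\cdot\chi_C=1$, i.e. the product of its edge signs is $-1$. -}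

module Defs where

open import Level using (0ℓ)
open import Algebra.Bundles using (CommutativeRing)
open import Algebra.Bundles.Raw using (RawRing)
import Algebra.Definitions.RawMonoid as RawMonoidDefs
open import Data.Bool using (Bool; true; false; _∧_; if_then_else_)
open import Data.Bool.Properties using (xor-∧-commutativeRing)
open import Data.Empty using (⊥-elim)
open import Data.Fin as Fin using (Fin; toℕ; finToFun)
import Data.Fin.Properties as Finₚ
open import Data.Integer as ℤ using (ℤ; 0ℤ; 1ℤ; -1ℤ)
open import Data.Nat as ℕ using (ℕ; suc)
open import Data.Nat.DivMod using (_mod_)
import Data.Nat.Properties as ℕₚ
open import Data.Product using (∃; ∃-syntax; _×_; _,_; proj₁; proj₂)
open import Data.Rational as ℚ using (ℚ; 0ℚ; 1ℚ; ½)
import Data.Rational.Properties as ℚₚ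
open import Data.Rational.Solver using (module +-*-Solver)
open import Data.Sum using (inj₁; inj₂)
open import Function.Definitions using (Injective)
open import Relation.Binary.Definitions using (Decidable; Symmetric; Irreflexive; tri<; tri≈; tri>)
open import Relation.Binary.PropositionalEquality
  using (_≡_; _≢_; refl; sym; trans; cong; subst)
open import Relation.Nullary using (¬_; yes; no; does)
open import Relation.Nullary.Decidable using (¬?; _×-dec_; _⊎-dec_; _→-dec_)

module Matrix {c ℓ} (R : RawRing c ℓ) where
  open RawRing R
  open RawMonoidDefs +-rawMonoid using (sum)

  Vector : ℕ → Set c
  Vector N = Fin N → Carrier

  Mat : ℕ → Set c
  Mat N = Fin N → Fin N → Carrier

  infixl 7 _*ᴹ_ _*ⱽ_

  _*ᴹ_ : ∀ {N} → Mat N → Mat N → Mat N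
  (A *ᴹ B) i k = sum λ j → A i j * B j k

  _*ⱽ_ : ∀ {N} → Mat N → Vector N → Vector N
  (A *ⱽ v) i = sum λ j → A i j * v j

  scalar : ∀ {N} → Carrier → Mat N
  scalar c i j = if does (i Fin.≟ j) then c else 0#

record Graph : Set₁ where
  field
    order   : ℕ
    Adj     : Fin order → Fin order → Set
    adj?    : Decidable Adj
    symm    : Symmetric Adj
    irrefl  : Irreflexive _≡_ Adj

  Vertex : Set
  Vertex = Fin order

open Graph public using (Vertex)

-- An undirected edge is stored once, with its endpoints in increasing
-- order.  The proof fields are irrelevant, so that an edge is determined
-- by its endpoints.
record Edge (G : Graph) : Set where
  constructor mkEdge
  open Graph G using (Adj)
  field
    src tgt   : Vertex G
    .ordered  : src Fin.< tgt
    .adjacent : Adj src tgt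

-- The edge joining two adjacent vertices given in either order.
edge : (G : Graph) {u v : Vertex G} → Graph.Adj G u v → Edge G
edge G {u} {v} uv with Finₚ.<-cmp u v
... | tri< u<v _ _ = mkEdge u v u<v uv
... | tri≈ _ u≡v _ = ⊥-elim (Graph.irrefl G u≡v uv)
... | tri> _ _ v<u = mkEdge v u v<u (Graph.symm G uv)

-- The field with two elements: addition is xor, multiplication is ∧.
F₂ : Set
F₂ = Bool

open RawMonoidDefs (CommutativeRing.+-rawMonoid xor-∧-commutativeRing)
  using () renaming (sum to sumF₂)

-- F₂ᴱ
EdgeVector : Graph → Set
EdgeVector G = Edge G → F₂

dot : (G : Graph) → EdgeVector G → EdgeVector G → F₂
dot G s t = sumF₂ λ u → sumF₂ λ v → term u v
  where
  term : Vertex G → Vertex G → F₂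
  term u v with (u Finₚ.<? v) ×-dec Graph.adj? G u v
  ... | yes (u<v , uv) = s (mkEdge u v u<v uv) ∧ t (mkEdge u v u<v uv)
  ... | no  _          = false

-- σₑ = (-1)^{sₑ}
sign : F₂ → ℤ
sign false = 1ℤ
sign true  = -1ℤ

signedAdjacency : (G : Graph) → EdgeVector G → Matrix.Mat ℤ.+-*-rawRing (Graph.order G)
signedAdjacency G s u v with Graph.adj? G u v
... | yes uv = sign (s (edge G uv))
... | no  _  = 0ℤ

next : ∀ {k} → Fin k → Fin k
next {suc k} i = suc (toℕ i) mod suc k

record Cycle (G : Graph) (k : ℕ) : Set where
  field
    length≥3  : 3 ℕ.≤ k
    vertex    : Fin k → Vertex G
    injective : Injective _≡_ _≡_ vertex
    adjacent  : ∀ i → Graph.Adj G (vertex i) (vertex (next i))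

-- The indicator vector of the edge set of a cycle.
χ : {G : Graph} {k : ℕ} → Cycle G k → EdgeVector G
χ C e = does (Finₚ.any? λ i →
    ((src Fin.≟ vertex i) ×-dec (tgt Fin.≟ vertex (next i)))
    ⊎-dec
    ((src Fin.≟ vertex (next i)) ×-dec (tgt Fin.≟ vertex i)))
  where
  open Cycle C
  open Edge e

Unbalanced : {G : Graph} {k : ℕ} → EdgeVector G → Cycle G k → Set
Unbalanced {G} s C = dot G s (χ C) ≡ true

All4CyclesUnbalanced : (G : Graph) → EdgeVector G → Set
All4CyclesUnbalanced G s = (C : Cycle G 4) → Unbalanced s C

-- finToFun is the bijection Fin (2 ^ n) → (Fin n → Fin 2), so a vertex
-- is identified with a 0/1-vector of length n.
bit : ∀ {n} → Fin (2 ℕ.^ n) → Fin n → Fin 2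
bit {n} u = finToFun {2} {n} u

DifferInOneBit : (n : ℕ) → Fin (2 ℕ.^ n) → Fin (2 ℕ.^ n) → Set
DifferInOneBit n u v =
  ∃[ i ] (bit {n} u i ≢ bit {n} v i × (∀ j → j ≢ i → bit {n} u j ≡ bit {n} v j))

Q : ℕ → Graph
Q n = record
  { order  = 2 ℕ.^ n
  ; Adj    = DifferInOneBit n
  ; adj?   = λ u v → Finₚ.any? λ i →
               ¬? (bit {n} u i Fin.≟ bit {n} v i)
               ×-dec Finₚ.all? λ j → ¬? (j Fin.≟ i) →-dec (bit {n} u j Fin.≟ bit {n} v j)
  ; symm   = λ (i , ui≢vi , same) →
               i , (λ eq → ui≢vi (sym eq)) , λ j j≢i → sym (same j j≢i)
  ; irrefl = λ { refl (i , ui≢ui , _) → ui≢ui refl }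
  }

-- A real number is a Cauchy sequence of rationals with a modulus of
-- convergence; _≈_ below is the equality of real numbers.
IsCauchy : (ℕ → ℚ) → Set
IsCauchy x = ∀ ε → 0ℚ ℚ.< ε →
  ∃[ N ] (∀ m n → N ℕ.≤ m → N ℕ.≤ n → ℚ.∣ x m ℚ.- x n ∣ ℚ.< ε)

record ℝ : Set where
  constructor mkℝ
  field
    seq    : ℕ → ℚ
    cauchy : IsCauchy seq

open ℝ public

infix 4 _≈_ _≤_

_≈_ : ℝ → ℝ → Set
x ≈ y = ∀ ε → 0ℚ ℚ.< ε →
  ∃[ N ] (∀ n → N ℕ.≤ n → ℚ.∣ seq x n ℚ.- seq y n ∣ ℚ.< ε)

_≤_ : ℝ → ℝ → Set
x ≤ y = ∀ ε → 0ℚ ℚ.< ε →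
  ∃[ N ] (∀ n → N ℕ.≤ n → seq x n ℚ.< seq y n ℚ.+ ε)

half-pos : ∀ {ε} → 0ℚ ℚ.< ε → 0ℚ ℚ.< ½ ℚ.* ε
half-pos {ε} 0<ε = ℚₚ.positive⁻¹ _ {{ℚₚ.pos*pos⇒pos ½ ε {{ℚ.positive 0<ε}}}}

half+half : ∀ ε → ½ ℚ.* ε ℚ.+ ½ ℚ.* ε ≡ ε
half+half ε = trans (sym (ℚₚ.*-distribʳ-+ ε ½ ½)) (ℚₚ.*-identityˡ ε)

const-cauchy : ∀ q → IsCauchy (λ _ → q)
const-cauchy q ε 0<ε = 0 , λ _ _ _ _ →
  subst (λ d → ℚ.∣ d ∣ ℚ.< ε) (sym (ℚₚ.+-inverseʳ q)) 0<ε

+-cauchy : ∀ x y → IsCauchy (λ n → seq x n ℚ.+ seq y n)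
+-cauchy x y ε 0<ε with cauchy x (½ ℚ.* ε) (half-pos 0<ε) | cauchy y (½ ℚ.* ε) (half-pos 0<ε)
... | M , hx | N , hy = M ℕ.⊔ N , λ m n m≥ n≥ →
  let x₁ = seq x m ; x₂ = seq x n ; y₁ = seq y m ; y₂ = seq y n in begin-strict
  ℚ.∣ (x₁ ℚ.+ y₁) ℚ.- (x₂ ℚ.+ y₂) ∣
    ≡⟨ cong ℚ.∣_∣ (solve 4 (λ a b c d → (a :+ b) :- (c :+ d) := (a :- c) :+ (b :- d)) refl x₁ y₁ x₂ y₂) ⟩
  ℚ.∣ (x₁ ℚ.- x₂) ℚ.+ (y₁ ℚ.- y₂) ∣
    ≤⟨ ℚₚ.∣p+q∣≤∣p∣+∣q∣ (x₁ ℚ.- x₂) (y₁ ℚ.- y₂) ⟩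
  ℚ.∣ x₁ ℚ.- x₂ ∣ ℚ.+ ℚ.∣ y₁ ℚ.- y₂ ∣
    <⟨ ℚₚ.+-mono-< (hx m n (ℕₚ.m⊔n≤o⇒m≤o M N m≥) (ℕₚ.m⊔n≤o⇒m≤o M N n≥))
                   (hy m n (ℕₚ.m⊔n≤o⇒n≤o M N m≥) (ℕₚ.m⊔n≤o⇒n≤o M N n≥)) ⟩
  ½ ℚ.* ε ℚ.+ ½ ℚ.* ε
    ≡⟨ half+half ε ⟩
  ε ∎
  where
  open ℚₚ.≤-Reasoning
  open +-*-Solver

neg-cauchy : ∀ x → IsCauchy (λ n → ℚ.- seq x n)
neg-cauchy x ε 0<ε with cauchy x ε 0<ε
... | N , h = N , λ m n m≥ n≥ → subst (ℚ._< ε) (lem (seq x m) (seq x n)) (h m n m≥ n≥)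
  where
  open +-*-Solver
  lem : ∀ p q → ℚ.∣ p ℚ.- q ∣ ≡ ℚ.∣ (ℚ.- p) ℚ.- (ℚ.- q) ∣
  lem p q = trans (sym (ℚₚ.∣-p∣≡∣p∣ (p ℚ.- q)))
    (cong ℚ.∣_∣ (solve 2 (λ a b → :- (a :- b) := (:- a) :- (:- b)) refl p q))

∣p∣-∣q∣≤∣p-q∣ : ∀ p q → ℚ.∣ p ∣ ℚ.- ℚ.∣ q ∣ ℚ.≤ ℚ.∣ p ℚ.- q ∣
∣p∣-∣q∣≤∣p-q∣ p q = begin
  ℚ.∣ p ∣ ℚ.- ℚ.∣ q ∣
    ≡⟨ cong (λ r → ℚ.∣ r ∣ ℚ.- ℚ.∣ q ∣) (solve 2 (λ a b → a := (a :- b) :+ b) refl p q) ⟩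
  ℚ.∣ (p ℚ.- q) ℚ.+ q ∣ ℚ.- ℚ.∣ q ∣
    ≤⟨ ℚₚ.+-monoˡ-≤ (ℚ.- ℚ.∣ q ∣) (ℚₚ.∣p+q∣≤∣p∣+∣q∣ (p ℚ.- q) q) ⟩
  (ℚ.∣ p ℚ.- q ∣ ℚ.+ ℚ.∣ q ∣) ℚ.- ℚ.∣ q ∣
    ≡⟨ solve 2 (λ a b → (a :+ b) :- b := a) refl ℚ.∣ p ℚ.- q ∣ ℚ.∣ q ∣ ⟩
  ℚ.∣ p ℚ.- q ∣ ∎
  where
  open ℚₚ.≤-Reasoning
  open +-*-Solver

∣p-q∣≡∣q-p∣ : ∀ p q → ℚ.∣ p ℚ.- q ∣ ≡ ℚ.∣ q ℚ.- p ∣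
∣p-q∣≡∣q-p∣ p q = trans (sym (ℚₚ.∣-p∣≡∣p∣ (p ℚ.- q)))
  (cong ℚ.∣_∣ (solve 2 (λ a b → :- (a :- b) := b :- a) refl p q))
  where open +-*-Solver

∣∣p∣-∣q∣∣≤∣p-q∣ : ∀ p q → ℚ.∣ ℚ.∣ p ∣ ℚ.- ℚ.∣ q ∣ ∣ ℚ.≤ ℚ.∣ p ℚ.- q ∣
∣∣p∣-∣q∣∣≤∣p-q∣ p q with ℚₚ.∣p∣≡p∨∣p∣≡-p (ℚ.∣ p ∣ ℚ.- ℚ.∣ q ∣)
... | inj₁ eq = subst (ℚ._≤ ℚ.∣ p ℚ.- q ∣) (sym eq) (∣p∣-∣q∣≤∣p-q∣ p q)
... | inj₂ eq = begin
  ℚ.∣ ℚ.∣ p ∣ ℚ.- ℚ.∣ q ∣ ∣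
    ≡⟨ eq ⟩
  ℚ.- (ℚ.∣ p ∣ ℚ.- ℚ.∣ q ∣)
    ≡⟨ solve 2 (λ a b → :- (a :- b) := b :- a) refl ℚ.∣ p ∣ ℚ.∣ q ∣ ⟩
  ℚ.∣ q ∣ ℚ.- ℚ.∣ p ∣
    ≤⟨ ∣p∣-∣q∣≤∣p-q∣ q p ⟩
  ℚ.∣ q ℚ.- p ∣
    ≡⟨ ∣p-q∣≡∣q-p∣ q p ⟩
  ℚ.∣ p ℚ.- q ∣ ∎
  where
  open ℚₚ.≤-Reasoning
  open +-*-Solver

abs-cauchy : ∀ x → IsCauchy (λ n → ℚ.∣ seq x n ∣)
abs-cauchy x ε 0<ε with cauchy x ε 0<ε
... | N , h = N , λ m n m≥ n≥ →
  ℚₚ.≤-<-trans (∣∣p∣-∣q∣∣≤∣p-q∣ (seq x m) (seq x n)) (h m n m≥ n≥)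

eventually-bounded : ∀ x →
  ∃[ B ] (0ℚ ℚ.< B × ∃[ N ] (∀ n → N ℕ.≤ n → ℚ.∣ seq x n ∣ ℚ.< B))
eventually-bounded x with cauchy x 1ℚ (ℚₚ.positive⁻¹ 1ℚ)
... | N , h = 1ℚ ℚ.+ ℚ.∣ seq x N ∣
    , ℚₚ.+-mono-<-≤ (ℚₚ.positive⁻¹ 1ℚ) (ℚₚ.0≤∣p∣ (seq x N))
    , N , λ n n≥ → begin-strict
  ℚ.∣ seq x n ∣
    ≡⟨ cong ℚ.∣_∣ (solve 2 (λ a b → a := (a :- b) :+ b) refl (seq x n) (seq x N)) ⟩
  ℚ.∣ (seq x n ℚ.- seq x N) ℚ.+ seq x N ∣
    ≤⟨ ℚₚ.∣p+q∣≤∣p∣+∣q∣ (seq x n ℚ.- seq x N) (seq x N) ⟩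
  ℚ.∣ seq x n ℚ.- seq x N ∣ ℚ.+ ℚ.∣ seq x N ∣
    <⟨ ℚₚ.+-monoˡ-< ℚ.∣ seq x N ∣ (h n N n≥ ℕₚ.≤-refl) ⟩
  1ℚ ℚ.+ ℚ.∣ seq x N ∣ ∎
  where
  open ℚₚ.≤-Reasoning
  open +-*-Solver

*-mono-≤-bounds : ∀ p q {a b} → ℚ.∣ p ∣ ℚ.≤ a → ℚ.∣ q ∣ ℚ.≤ b → ℚ.∣ p ℚ.* q ∣ ℚ.≤ a ℚ.* b
*-mono-≤-bounds p q {a} {b} p≤a q≤b = begin
  ℚ.∣ p ℚ.* q ∣       ≡⟨ ℚₚ.∣p*q∣≡∣p∣*∣q∣ p q ⟩
  ℚ.∣ p ∣ ℚ.* ℚ.∣ q ∣ ≤⟨ ℚₚ.*-monoˡ-≤-nonNeg ℚ.∣ p ∣ {{ℚₚ.∣-∣-nonNeg p}} q≤b ⟩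
  ℚ.∣ p ∣ ℚ.* b       ≤⟨ ℚₚ.*-monoʳ-≤-nonNeg b {{ℚ.nonNegative (ℚₚ.≤-trans (ℚₚ.0≤∣p∣ q) q≤b)}} p≤a ⟩
  a ℚ.* b             ∎
  where open ℚₚ.≤-Reasoning

*-cauchy : ∀ x y → IsCauchy (λ n → seq x n ℚ.* seq y n)
*-cauchy x y ε 0<ε = K , bound
  where
  open ℚₚ.≤-Reasoning
  open +-*-Solver
  Bx = proj₁ (eventually-bounded x)
  By = proj₁ (eventually-bounded y)
  Nx = proj₁ (proj₂ (proj₂ (eventually-bounded x)))
  Ny = proj₁ (proj₂ (proj₂ (eventually-bounded y)))
  instance
    posB : ℚ.Positive (Bx ℚ.+ By)
    posB = ℚ.positive (ℚₚ.+-mono-< (proj₁ (proj₂ (eventually-bounded x)))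
                                   (proj₁ (proj₂ (eventually-bounded y))))
    nzB : ℚ.NonZero (Bx ℚ.+ By)
    nzB = ℚₚ.pos⇒nonZero (Bx ℚ.+ By)
  η = ½ ℚ.* ε
  δ = η ℚ.* (ℚ.1/ (Bx ℚ.+ By))
  0<δ : 0ℚ ℚ.< δ
  0<δ = ℚₚ.positive⁻¹ δ {{ℚₚ.pos*pos⇒pos η {{ℚ.positive (half-pos 0<ε)}} _ {{ℚₚ.1/pos⇒pos (Bx ℚ.+ By)}}}}
  Mx = proj₁ (cauchy x δ 0<δ)
  My = proj₁ (cauchy y δ 0<δ)
  K = (Nx ℕ.⊔ Ny) ℕ.⊔ (Mx ℕ.⊔ My)
  η<ε : η ℚ.< ε
  η<ε = begin-strict
    η         ≡⟨ ℚₚ.+-identityʳ η ⟨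
    η ℚ.+ 0ℚ  <⟨ ℚₚ.+-monoʳ-< η (half-pos 0<ε) ⟩
    η ℚ.+ η   ≡⟨ half+half ε ⟩
    ε         ∎
  bound : ∀ m n → K ℕ.≤ m → K ℕ.≤ n →
    ℚ.∣ seq x m ℚ.* seq y m ℚ.- seq x n ℚ.* seq y n ∣ ℚ.< ε
  bound m n m≥ n≥ = begin-strict
    ℚ.∣ x₁ ℚ.* y₁ ℚ.- x₂ ℚ.* y₂ ∣
      ≡⟨ cong ℚ.∣_∣ (solve 4 (λ a b c d → a :* b :- c :* d := a :* (b :- d) :+ (a :- c) :* d) refl x₁ y₁ x₂ y₂) ⟩
    ℚ.∣ x₁ ℚ.* (y₁ ℚ.- y₂) ℚ.+ (x₁ ℚ.- x₂) ℚ.* y₂ ∣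
      ≤⟨ ℚₚ.∣p+q∣≤∣p∣+∣q∣ (x₁ ℚ.* (y₁ ℚ.- y₂)) ((x₁ ℚ.- x₂) ℚ.* y₂) ⟩
    ℚ.∣ x₁ ℚ.* (y₁ ℚ.- y₂) ∣ ℚ.+ ℚ.∣ (x₁ ℚ.- x₂) ℚ.* y₂ ∣
      ≤⟨ ℚₚ.+-mono-≤
           (*-mono-≤-bounds x₁ (y₁ ℚ.- y₂) {Bx} {δ} (ℚₚ.<⇒≤ (bx m m≥)) (ℚₚ.<⇒≤ dy))
           (*-mono-≤-bounds (x₁ ℚ.- x₂) y₂ {δ} {By} (ℚₚ.<⇒≤ dx) (ℚₚ.<⇒≤ (by n n≥))) ⟩
    Bx ℚ.* δ ℚ.+ δ ℚ.* By
      ≡⟨ solve 4 (λ a b h i → a :* (h :* i) :+ (h :* i) :* b := h :* (i :* (a :+ b))) refl Bx By η (ℚ.1/ (Bx ℚ.+ By)) ⟩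
    η ℚ.* (ℚ.1/ (Bx ℚ.+ By) ℚ.* (Bx ℚ.+ By))
      ≡⟨ cong (η ℚ.*_) (ℚₚ.*-inverseˡ (Bx ℚ.+ By)) ⟩
    η ℚ.* 1ℚ
      ≡⟨ ℚₚ.*-identityʳ η ⟩
    η
      <⟨ η<ε ⟩
    ε ∎
    where
    x₁ = seq x m
    x₂ = seq x n
    y₁ = seq y m
    y₂ = seq y n
    Ns : ∀ {k} → K ℕ.≤ k → Nx ℕ.⊔ Ny ℕ.≤ k
    Ns = ℕₚ.m⊔n≤o⇒m≤o (Nx ℕ.⊔ Ny) (Mx ℕ.⊔ My)
    Ms : ∀ {k} → K ℕ.≤ k → Mx ℕ.⊔ My ℕ.≤ k
    Ms = ℕₚ.m⊔n≤o⇒n≤o (Nx ℕ.⊔ Ny) (Mx ℕ.⊔ My)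
    bx : ∀ k → K ℕ.≤ k → ℚ.∣ seq x k ∣ ℚ.< Bx
    bx k k≥ = proj₂ (proj₂ (proj₂ (eventually-bounded x))) k (ℕₚ.m⊔n≤o⇒m≤o Nx Ny (Ns k≥))
    by : ∀ k → K ℕ.≤ k → ℚ.∣ seq y k ∣ ℚ.< By
    by k k≥ = proj₂ (proj₂ (proj₂ (eventually-bounded y))) k (ℕₚ.m⊔n≤o⇒n≤o Nx Ny (Ns k≥))
    dx : ℚ.∣ x₁ ℚ.- x₂ ∣ ℚ.< δ
    dx = proj₂ (cauchy x δ 0<δ) m n (ℕₚ.m⊔n≤o⇒m≤o Mx My (Ms m≥)) (ℕₚ.m⊔n≤o⇒m≤o Mx My (Ms n≥))
    dy : ℚ.∣ y₁ ℚ.- y₂ ∣ ℚ.< δ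
    dy = proj₂ (cauchy y δ 0<δ) m n (ℕₚ.m⊔n≤o⇒n≤o Mx My (Ms m≥)) (ℕₚ.m⊔n≤o⇒n≤o Mx My (Ms n≥))

infixl 6 _+_
infixl 7 _*_
infix  8 -_

fromℤ : ℤ → ℝ
fromℤ z = mkℝ (λ _ → z ℚ./ 1) (const-cauchy (z ℚ./ 1))

_+_ : ℝ → ℝ → ℝ
x + y = mkℝ (λ n → seq x n ℚ.+ seq y n) (+-cauchy x y)

_*_ : ℝ → ℝ → ℝ
x * y = mkℝ (λ n → seq x n ℚ.* seq y n) (*-cauchy x y)

-_ : ℝ → ℝ
- x = mkℝ (λ n → ℚ.- seq x n) (neg-cauchy x)

∣_∣ : ℝ → ℝ
∣ x ∣ = mkℝ (λ n → ℚ.∣ seq x n ∣) (abs-cauchy x)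

ℝ-rawRing : RawRing 0ℓ 0ℓ
ℝ-rawRing = record
  { Carrier = ℝ
  ; _≈_     = _≈_
  ; _+_     = _+_
  ; _*_     = _*_
  ; -_      = -_
  ; 0#      = fromℤ 0ℤ
  ; 1#      = fromℤ 1ℤ
  }

IsSqrt : ℝ → ℕ → Set
IsSqrt r n = fromℤ 0ℤ ≤ r × r * r ≈ fromℤ (ℤ.+ n)

open Matrix ℝ-rawRing using () renaming (Mat to Matℝ; _*ⱽ_ to _*ⱽℝ_)

IsEigenvalue : ∀ {N} → Matℝ N → ℝ → Set
IsEigenvalue M μ = ∃[ v ]
  (¬ (∀ i → v i ≈ fromℤ 0ℤ) × (∀ i → (M *ⱽℝ v) i ≈ μ * v i))

-- r = ρ(M), i.e. r is the maximum of ∣μ∣ over the real eigenvalues μ of M.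
-- For symmetric M, as here, all eigenvalues are real.
IsSpectralRadius : ∀ {N} → Matℝ N → ℝ → Set
IsSpectralRadius M r =
  (∃[ μ ] (IsEigenvalue M μ × ∣ μ ∣ ≈ r)) × (∀ μ → IsEigenvalue M μ → ∣ μ ∣ ≤ r)

toℝ : ∀ {N} → Matrix.Mat ℤ.+-*-rawRing N → Matℝ N
toℝ A u v = fromℤ (A u v)

open Matrix ℤ.+-*-rawRing public using (_*ᴹ_; scalar)

-- On Q_n write A² as a sum over walks u → u + eᵢ → u + eᵢ + eⱼ.  For i ≠ j the
-- walks (i , j) and (j , i) have the same ends and run around the two sides of a
-- 4-cycle, so unbalancedness makes them cancel, and the n walks with i = j return to u
-- with weight 1.  A solution is s({u , u + eᵢ}) = Σ_{k<i} uₖ.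
--
-- If A² = nI and Av = μv, then (n - μ²)v = 0; were |μ| > √n, the coefficient would be
-- bounded away from 0 and v would vanish.  Conversely, as (A - √n)(A + √n) = 0, the
-- vector (A + √n)e is in the √n-eigenspace for every basis vector e; for n > 0 it is
-- nonzero because A has zero diagonal.
module Submission where

open import Defs
open import Algebra.Bundles using (CommutativeMonoid; CommutativeRing)
open import Algebra.Bundles.Raw using (RawRing)
import Algebra.Definitions.RawMonoid as RawMonoidDefs
import Algebra.Properties.CommutativeMonoid.Sum as CommutativeMonoidSum
import Algebra.Properties.Semiring.Sum as SemiringSum
open import Data.Bool using (Bool; true; false; _∧_; _∨_; _xor_; not; if_then_else_)
open import Data.Bool.Properties using (xor-identityʳ; xor-∧-commutativeRing)
open import Data.Empty using (⊥-elim)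
open import Data.Fin as Fin using (Fin; zero; suc; opposite; funToFin)
open import Data.Fin.Patterns using (0F; 1F; 2F; 3F)
import Data.Fin.Properties as Finₚ
open import Data.Integer as ℤ using (ℤ; 0ℤ; 1ℤ; +_)
import Data.Integer.Properties as ℤₚ
import Data.Integer.Solver as ℤ-Solver
open import Data.Nat as ℕ using (ℕ; zero; suc)
import Data.Nat.Properties as ℕₚ
open import Data.Product using (∃; ∃-syntax; _×_; _,_; proj₁; proj₂)
open import Data.Rational as ℚ using (ℚ; 0ℚ; 1ℚ; ½)
import Data.Rational.Properties as ℚₚ
open import Data.Rational.Solver using (module +-*-Solver)
open import Data.Rational.Unnormalised as ℚᵘ using (mkℚᵘ)
import Data.Rational.Unnormalised.Properties as ℚᵘₚ
open import Data.Sum using (_⊎_; inj₁; inj₂)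
open import Function using (_∘_)
open import Function.Definitions using (Injective)
open import Relation.Binary.Definitions using (tri<; tri≈; tri>)
open import Relation.Binary.PropositionalEquality
open import Relation.Nullary using (¬_; Dec; yes; no; does)
open import Relation.Nullary.Decidable using (_×-dec_; _⊎-dec_; dec-true; dec-false)
open import Relation.Nullary.Negation using (contradiction)

open Matrix ℤ.+-*-rawRing using (Mat)
open Matrix ℝ-rawRing using () renaming (_*ⱽ_ to _*ⱽℝ_)
open RawMonoidDefs (RawRing.+-rawMonoid ℝ-rawRing) using () renaming (sum to sumℝ)

-- Operations on reals act termwise, so `x ≈ y` unfolds to `Null` of the termwise difference. At
-- each index a real vector is a rational one and `A` is an integer matrix, so consequences of A² =
-- nI are exact rational identities there. Error enters only through the eigenvalue equation and
-- through n - `approx`²; both are null sequences, a class closed under sums and under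
-- multiplication by a real.
--
-- The order of two reals cannot be decided, so |μ| ≤ √n is proved for each ε separately: one
-- comparison of rationals at a late index gives either the bound up to ε or a gap η that persists
-- at all later indices, and the gap makes v vanish.
--
-- For n = 0 the vector (A + √n)e is zero; there A = 0 and e itself is the eigenvector.
--
-- On the combinatorial side, `dot` sums over stored edges and `χ` tests for existence, while the
-- cancellation of walks needs four labels in cyclic order; `dot-cycle` bridges the two.

-- Finite sums restricted by Boolean conditions

module Restriction {c ℓ} (M : CommutativeMonoid c ℓ) where
  open CommutativeMonoid M using (Carrier; ε; identityʳ; identityˡ; ∙-congˡ)
    renaming (_≈_ to _≋_; sym to ≈-sym; trans to ≈-trans; reflexive to ≈-reflexive)
  open CommutativeMonoidSum M

  infix 5 _when_

  _when_ : Carrier → Bool → Carrier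
  x when b = if b then x else ε

  ε-when : ∀ b → ε when b ≡ ε
  ε-when false = refl
  ε-when true  = refl

  sum-ε : ∀ {n} (f : Fin n → Carrier) → (∀ i → f i ≋ ε) → sum f ≋ ε
  sum-ε {n} f f≈ε = ≈-trans (sum-cong-≋ f≈ε) (sum-replicate-zero n)

  sum-δ : ∀ {n} (f : Fin n → Carrier) i → sum (λ j → f j when does (j Fin.≟ i)) ≋ f i
  sum-δ {suc n} f zero    = ≈-trans (∙-congˡ (sum-replicate-zero n)) (identityʳ _)
  sum-δ {suc n} f (suc i) = ≈-trans (identityˡ _) (sum-δ (f ∘ suc) i)

  sum-δ₂ : ∀ {m n} (f : Fin m → Fin n → Carrier) i j →
    sum (λ k → sum λ l → f k l when does (k Fin.≟ i) ∧ does (l Fin.≟ j)) ≋ f i j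
  sum-δ₂ {n = n} f i j = ≈-trans (sum-cong-≋ row) (sum-δ (λ k → f k j) i)
    where
    row : ∀ k → sum (λ l → f k l when does (k Fin.≟ i) ∧ does (l Fin.≟ j)) ≋ (f k j when does (k Fin.≟ i))
    row k with does (k Fin.≟ i)
    ... | true  = sum-δ (f k) j
    ... | false = sum-replicate-zero n

  -- Inserting the indicator of j = φ i, which for j in the image holds for a single i by
  -- injectivity, gives a double sum. Exchanging its order collapses the sum over j; terms off the
  -- image vanish by hypothesis.
  sum-reindex : ∀ {m n} (φ : Fin m → Fin n) → Injective _≡_ _≡_ φ → (f : Fin n → Carrier) →
    (∀ j → (∀ i → j ≢ φ i) → f j ≋ ε) → sum f ≋ sum (f ∘ φ)
  sum-reindex φ φ-injective f f-supported =
    ≈-trans (sum-cong-≋ split) (≈-trans (∑-comm restricted) (sum-cong-≋ λ i → sum-δ f (φ i)))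
    where
    restricted : Fin _ → Fin _ → Carrier
    restricted j i = f j when does (j Fin.≟ φ i)
    split : ∀ j → f j ≋ sum (restricted j)
    split j with Finₚ.any? (λ i → j Fin.≟ φ i)
    ... | no ∄i = ≈-trans (f-supported j j∉) (≈-sym (sum-ε _ λ i →
            ≈-reflexive (cong (f j when_) (dec-false (j Fin.≟ φ i) (j∉ i)))))
      where
      j∉ : ∀ i → j ≢ φ i
      j∉ i j≡ = ∄i (i , j≡)
    ... | yes (i , refl) = ≈-trans (≈-sym (sum-δ (λ _ → f (φ i)) i)) (≈-reflexive (sum-cong-≗ λ k →
            cong (f (φ i) when_) (same k)))
      where
      same : ∀ k → does (k Fin.≟ i) ≡ does (φ i Fin.≟ φ k)
      same k with k Fin.≟ i
      ... | yes refl = sym (dec-true (φ k Fin.≟ φ k) refl)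
      ... | no k≢i   = sym (dec-false (φ i Fin.≟ φ k) λ eq → k≢i (sym (φ-injective eq)))

-- Sums in the two-element field

xor-commutativeMonoid : CommutativeMonoid _ _
xor-commutativeMonoid = CommutativeRing.+-commutativeMonoid xor-∧-commutativeRing

open module F₂-sum = CommutativeMonoidSum xor-commutativeMonoid using ()
  renaming (sum to sumF₂; sum-cong-≗ to sumF₂-cong; ∑-distrib-+ to sumF₂-xor; ∑-comm to sumF₂-comm)
open module F₂-when = Restriction xor-commutativeMonoid using ()
  renaming (_when_ to _whenF₂_; sum-δ to sumF₂-δ; sum-δ₂ to sumF₂-δ₂)

xor-≡-∨ : ∀ a b → ¬ (a ≡ true × b ≡ true) → a xor b ≡ a ∨ b
xor-≡-∨ false b     _    = refl
xor-≡-∨ true  false _    = refl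
xor-≡-∨ true  true  ¬a∧b = contradiction (refl , refl) ¬a∧b

does-true : ∀ {p} {P : Set p} (P? : Dec P) → does P? ≡ true → P
does-true (yes p) _ = p

-- At most one condition holds, so xor never meets two true terms and agrees with disjunction. This
-- turns the existential inside `χ` into a sum.
does-any : ∀ {n p} {P : Fin n → Set p} (P? : ∀ i → Dec (P i)) →
  (∀ {i j} → P i → P j → i ≡ j) → sumF₂ (does ∘ P?) ≡ does (Finₚ.any? P?)
does-any {zero}  P? unique = refl
does-any {suc n} P? unique = trans
  (cong (does (P? zero) xor_) (does-any (P? ∘ suc) λ p q → Finₚ.suc-injective (unique p q)))
  (xor-≡-∨ (does (P? zero)) (does (Finₚ.any? (P? ∘ suc))) λ (p , q) → Finₚ.0≢1+n (unique (does-true (P? zero) p)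
    (proj₂ (does-true (Finₚ.any? (P? ∘ suc)) q))))

whenF₂-xor : ∀ x a b → (x whenF₂ (a xor b)) ≡ (x whenF₂ a) xor (x whenF₂ b)
whenF₂-xor x     false b     = refl
whenF₂-xor false true  false = refl
whenF₂-xor false true  true  = refl
whenF₂-xor true  true  false = refl
whenF₂-xor true  true  true  = refl

whenF₂-sum : ∀ {n} x (f : Fin n → F₂) → (x whenF₂ sumF₂ f) ≡ sumF₂ (λ i → x whenF₂ f i)
whenF₂-sum {zero}  x f = refl
whenF₂-sum {suc n} x f = trans (whenF₂-xor x (f zero) (sumF₂ (f ∘ suc))) (cong ((x whenF₂ f zero) xor_) (whenF₂-sum x (f ∘ suc)))

∧-when : ∀ x b → x ∧ b ≡ (x whenF₂ b)
∧-when false false = refl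
∧-when false true  = refl
∧-when true  false = refl
∧-when true  true  = refl

-- Edge labels and the dot product with a 4-cycle

module _ (G : Graph) where
  open Graph G using (Adj; adj?; symm; irrefl)

  edge-unique : ∀ {u v} (a b : Adj u v) → edge G a ≡ edge G b
  edge-unique {u} {v} a b with Finₚ.<-cmp u v
  ... | tri< _ _ _   = refl
  ... | tri≈ _ u≡v _ = contradiction a (irrefl u≡v)
  ... | tri> _ _ _   = refl

  edge-sym : ∀ {u v} (a : Adj u v) (b : Adj v u) → edge G a ≡ edge G b
  edge-sym {u} {v} a b with Finₚ.<-cmp u v | Finₚ.<-cmp v u
  ... | tri≈ _ u≡v _ | _            = contradiction a (irrefl u≡v)
  ... | _            | tri≈ _ v≡u _ = contradiction b (irrefl v≡u)
  ... | tri< _ _ _   | tri> _ _ _   = refl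
  ... | tri> _ _ _   | tri< _ _ _   = refl
  ... | tri< u<v _ _ | tri< _ _ u≮v = contradiction u<v u≮v
  ... | tri> _ _ v<u | tri> v≮u _ _ = contradiction v<u v≮u

  module _ (s : EdgeVector G) where

    -- The signing extended by zero to all ordered pairs, so that sums along a cycle carry no
    -- adjacency proofs.
    label : Vertex G → Vertex G → F₂
    label u v with adj? u v
    ... | yes a = s (edge G a)
    ... | no  _ = false

    label-edge : ∀ {u v} (a : Adj u v) → label u v ≡ s (edge G a)
    label-edge {u} {v} a with adj? u v
    ... | yes b = cong s (edge-unique b a)
    ... | no ¬a = contradiction a ¬a

    label-sym : ∀ u v → label u v ≡ label v u
    label-sym u v with adj? u v | adj? v u
    ... | yes a | yes b = cong s (edge-sym a b)
    ... | yes a | no ¬b = contradiction (symm a) ¬b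
    ... | no ¬a | yes b = contradiction (symm b) ¬a
    ... | no _  | no _  = refl

    signedAdjacency-adjacent : ∀ {u v} → Adj u v → signedAdjacency G s u v ≡ sign (label u v)
    signedAdjacency-adjacent {u} {v} a with adj? u v
    ... | yes _ = refl
    ... | no ¬a = contradiction a ¬a

    -- The weight with which `dot` sees a pair: an edge counts only in its increasing order. Adding
    -- both orders therefore recovers `label`.
    orientedLabel : Vertex G → Vertex G → F₂
    orientedLabel u v = label u v whenF₂ does (u Finₚ.<? v)

    orientedLabel-edge : ∀ {u v} (u<v : u Fin.< v) (a : Adj u v) → orientedLabel u v ≡ s (mkEdge u v u<v a)
    orientedLabel-edge {u} {v} u<v a rewrite dec-true (u Finₚ.<? v) u<v with Finₚ.<-cmp u v | label-edge a
    ... | tri< _ _ _   | eq = eq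
    ... | tri≈ u≮v _ _ | _  = contradiction u<v u≮v
    ... | tri> u≮v _ _ | _  = contradiction u<v u≮v

    orientedLabel-nonEdge : ∀ {u v} → ¬ (u Fin.< v × Adj u v) → orientedLabel u v ≡ false
    orientedLabel-nonEdge {u} {v} ¬edge with adj? u v
    ... | no _  = F₂-when.ε-when _
    ... | yes a rewrite dec-false (u Finₚ.<? v) (λ u<v → ¬edge (u<v , a)) = refl

    orientedLabel-xor : ∀ {u v} → Adj u v → orientedLabel u v xor orientedLabel v u ≡ label u v
    orientedLabel-xor {u} {v} a with Finₚ.<-cmp u v
    ... | tri≈ _ u≡v _ = contradiction a (irrefl u≡v)
    ... | tri< u<v _ v≮u rewrite dec-true (u Finₚ.<? v) u<v | dec-false (v Finₚ.<? u) v≮u = xor-identityʳ _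
    ... | tri> u≮v _ v<u rewrite dec-false (u Finₚ.<? v) u≮v | dec-true (v Finₚ.<? u) v<u = label-sym v u

    -- The summand of dot is a local function of its definition; unification recovers it.
    dotSummand : (t : EdgeVector G) →
      ∃ λ (f : Vertex G → Vertex G → F₂) → dot G s t ≡ sumF₂ {Graph.order G} λ u → sumF₂ {Graph.order G} (f u)
    dotSummand t = _ , refl

    module _ (C : Cycle G 4) where
      open Cycle C

      Traverses : Vertex G → Vertex G → Fin 4 → Set
      Traverses u v i = (u ≡ vertex i × v ≡ vertex (next i)) ⊎ (u ≡ vertex (next i) × v ≡ vertex i)

      traverses? : ∀ u v i → Dec (Traverses u v i)
      traverses? u v i = ((u Fin.≟ vertex i) ×-dec (v Fin.≟ vertex (next i)))
        ⊎-dec ((u Fin.≟ vertex (next i)) ×-dec (v Fin.≟ vertex i))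

      next-next-≢ : (i : Fin 4) → next (next i) ≢ i
      next-next-≢ 0F ()
      next-next-≢ 1F ()
      next-next-≢ 2F ()
      next-next-≢ 3F ()

      -- Steps taken in the same direction agree by injectivity of `vertex`. Steps taken in opposite
      -- directions would force `next` to be an involution at some index, which is impossible on a
      -- cycle of length 4.
      traverses-unique : ∀ {u v i j} → Traverses u v i → Traverses u v j → i ≡ j
      traverses-unique (inj₁ (p , _)) (inj₁ (q , _)) = injective (trans (sym p) q)
      traverses-unique (inj₂ (_ , p)) (inj₂ (_ , q)) = injective (trans (sym p) q)
      traverses-unique {j = j} (inj₁ (p , p′)) (inj₂ (q , q′)) = contradiction
        (trans (cong next (injective (trans (sym q) p))) (injective (trans (sym p′) q′))) (next-next-≢ j)
      traverses-unique {i = i} (inj₂ (p , p′)) (inj₁ (q , q′)) = contradiction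
        (trans (cong next (injective (trans (sym p) q))) (injective (trans (sym q′) p′))) (next-next-≢ i)

      traversed : Vertex G → Vertex G → F₂
      traversed u v = does (Finₚ.any? (traverses? u v))

      dotSummand-cycle : ∀ u v → proj₁ (dotSummand (χ C)) u v ≡ (orientedLabel u v whenF₂ traversed u v)
      dotSummand-cycle u v with (u Finₚ.<? v) ×-dec adj? u v
      ... | no ¬edge = trans (sym (F₂-when.ε-when (traversed u v)))
            (cong (_whenF₂ traversed u v) (sym (orientedLabel-nonEdge ¬edge)))
      ... | yes (u<v , a) = trans (∧-when (s (mkEdge u v u<v a)) (traversed u v))
            (cong (_whenF₂ traversed u v) (sym (orientedLabel-edge u<v a)))

      -- The pairs counted by `dot` carry no cyclic order. Writing `χ` as a sum over the steps of
      -- the cycle and moving that sum outermost isolates one step, which contributes its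
      -- `orientedLabel` in both directions, one of them zero.
      dot-cycle : dot G s (χ C) ≡ sumF₂ (λ i → label (vertex i) (vertex (next i)))
      dot-cycle = begin
        dot G s (χ C)
          ≡⟨ proj₂ (dotSummand (χ C)) ⟩
        (sumF₂ λ u → sumF₂ λ v → proj₁ (dotSummand (χ C)) u v)
          ≡⟨ (sumF₂-cong λ u → trans (sumF₂-cong (expand u)) (sumF₂-comm λ v i → along i u v)) ⟩
        (sumF₂ λ u → sumF₂ λ i → sumF₂ λ v → along i u v)
          ≡⟨ sumF₂-comm (λ u i → sumF₂ (along i u)) ⟩
        (sumF₂ λ i → sumF₂ λ u → sumF₂ λ v → along i u v)
          ≡⟨ sumF₂-cong collapse ⟩
        sumF₂ (λ i → label (vertex i) (vertex (next i))) ∎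
        where
        open ≡-Reasoning
        along forward backward : Fin 4 → Vertex G → Vertex G → F₂
        along i u v    = orientedLabel u v whenF₂ does (traverses? u v i)
        forward i u v  = orientedLabel u v whenF₂ does (u Fin.≟ vertex i) ∧ does (v Fin.≟ vertex (next i))
        backward i u v = orientedLabel u v whenF₂ does (u Fin.≟ vertex (next i)) ∧ does (v Fin.≟ vertex i)

        expand : ∀ u v → proj₁ (dotSummand (χ C)) u v ≡ sumF₂ (λ i → along i u v)
        expand u v = trans (dotSummand-cycle u v)
          (trans (cong (orientedLabel u v whenF₂_) (sym (does-any (traverses? u v) traverses-unique)))
                 (whenF₂-sum (orientedLabel u v) (does ∘ traverses? u v)))

        along-split : ∀ i u v → along i u v ≡ forward i u v xor backward i u v
        along-split i u v = trans
          -- Traversal in both directions by the same step would make that step a loop.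
          (cong (orientedLabel u v whenF₂_) (sym (xor-≡-∨ (does forward?) (does backward?) λ (p , q) →
            irrefl (trans (sym (proj₁ (does-true forward? p))) (proj₁ (does-true backward? q))) (adjacent i))))
          (whenF₂-xor (orientedLabel u v) (does forward?) (does backward?))
          where
          forward?  = (u Fin.≟ vertex i) ×-dec (v Fin.≟ vertex (next i))
          backward? = (u Fin.≟ vertex (next i)) ×-dec (v Fin.≟ vertex i)

        collapse : ∀ i → (sumF₂ λ u → sumF₂ λ v → along i u v) ≡ label (vertex i) (vertex (next i))
        collapse i = begin
          (sumF₂ λ u → sumF₂ λ v → along i u v)
            ≡⟨ (sumF₂-cong λ u → trans (sumF₂-cong (along-split i u)) (sumF₂-xor (forward i u) (backward i u))) ⟩
          (sumF₂ λ u → (sumF₂ λ v → forward i u v) xor (sumF₂ λ v → backward i u v))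
            ≡⟨ sumF₂-xor (λ u → sumF₂ (forward i u)) (λ u → sumF₂ (backward i u)) ⟩
          (sumF₂ λ u → sumF₂ λ v → forward i u v) xor (sumF₂ λ u → sumF₂ λ v → backward i u v)
            ≡⟨ cong₂ _xor_ (sumF₂-δ₂ orientedLabel (vertex i) (vertex (next i)))
                           (sumF₂-δ₂ orientedLabel (vertex (next i)) (vertex i)) ⟩
          orientedLabel (vertex i) (vertex (next i)) xor orientedLabel (vertex (next i)) (vertex i)
            ≡⟨ orientedLabel-xor (adjacent i) ⟩
          label (vertex i) (vertex (next i)) ∎

-- The hypercube: coordinate flips and squares

does-sym : ∀ {n} (i j : Fin n) → does (i Fin.≟ j) ≡ does (j Fin.≟ i)
does-sym i j with i Fin.≟ j
... | yes i≡j = sym (dec-true (j Fin.≟ i) (sym i≡j))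
... | no i≢j  = sym (dec-false (j Fin.≟ i) (i≢j ∘ sym))

opposite₂-involutive : (b : Fin 2) → opposite (opposite b) ≡ b
opposite₂-involutive 0F = refl
opposite₂-involutive 1F = refl

opposite₂-≢ : (b : Fin 2) → opposite b ≢ b
opposite₂-≢ 0F ()
opposite₂-≢ 1F ()

≢⇒≡-opposite₂ : {a b : Fin 2} → a ≢ b → b ≡ opposite a
≢⇒≡-opposite₂ {0F} {0F} a≢b = contradiction refl a≢b
≢⇒≡-opposite₂ {0F} {1F} a≢b = refl
≢⇒≡-opposite₂ {1F} {0F} a≢b = refl
≢⇒≡-opposite₂ {1F} {1F} a≢b = contradiction refl a≢b

funToFin-cong : ∀ {m n} {f g : Fin m → Fin n} → f ≗ g → funToFin f ≡ funToFin g
funToFin-cong {zero}  f≗g = refl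
funToFin-cong {suc m} f≗g = cong₂ Fin.combine (f≗g zero) (funToFin-cong (f≗g ∘ suc))

injective-from-< : ∀ {n a} {A : Set a} (f : Fin n → A) →
  (∀ i j → i Fin.< j → f i ≢ f j) → Injective _≡_ _≡_ f
injective-from-< f f-distinct {i} {j} fi≡fj with Finₚ.<-cmp i j
... | tri< i<j _ _ = contradiction fi≡fj (f-distinct i j i<j)
... | tri≈ _ i≡j _ = i≡j
... | tri> _ _ j<i = contradiction (sym fi≡fj) (f-distinct j i j<i)

module Hypercube (n : ℕ) where

  private
    V : Set
    V = Vertex (Q n)

    bits : V → Fin n → Fin 2
    bits = bit {n}

  bits-injective : {u v : V} → bits u ≗ bits v → u ≡ v
  bits-injective {u} {v} u≗v = trans (sym (Finₚ.funToFin-finToFin {n} {2} u))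
    (trans (funToFin-cong u≗v) (Finₚ.funToFin-finToFin {n} {2} v))

  toggle : Bool → Fin 2 → Fin 2
  toggle b x = if b then opposite x else x

  flip : Fin n → V → V
  flip i u = funToFin λ j → toggle (does (j Fin.≟ i)) (bits u j)

  bits-flip : ∀ i u j → bits (flip i u) j ≡ toggle (does (j Fin.≟ i)) (bits u j)
  bits-flip i u = Finₚ.finToFun-funToFin λ j → toggle (does (j Fin.≟ i)) (bits u j)

  bits-flip-≡ : ∀ i u → bits (flip i u) i ≡ opposite (bits u i)
  bits-flip-≡ i u = trans (bits-flip i u i) (cong (λ b → toggle b (bits u i)) (dec-true (i Fin.≟ i) refl))

  bits-flip-≢ : ∀ {i j} u → j ≢ i → bits (flip i u) j ≡ bits u j
  bits-flip-≢ {i} {j} u j≢i = trans (bits-flip i u j) (cong (λ b → toggle b (bits u j)) (dec-false (j Fin.≟ i) j≢i))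

  toggle-involutive : ∀ b x → toggle b (toggle b x) ≡ x
  toggle-involutive false x = refl
  toggle-involutive true  x = opposite₂-involutive x

  toggle-comm : ∀ b c x → toggle b (toggle c x) ≡ toggle c (toggle b x)
  toggle-comm false c     x = refl
  toggle-comm true  false x = refl
  toggle-comm true  true  x = refl

  bits-flip-flip : ∀ i j u k →
    bits (flip i (flip j u)) k ≡ toggle (does (k Fin.≟ i)) (toggle (does (k Fin.≟ j)) (bits u k))
  bits-flip-flip i j u k = trans (bits-flip i (flip j u) k) (cong (toggle _) (bits-flip j u k))

  flip-involutive : ∀ i u → flip i (flip i u) ≡ u
  flip-involutive i u = bits-injective λ k →
    trans (bits-flip-flip i i u k) (toggle-involutive (does (k Fin.≟ i)) (bits u k))

  flip-comm : ∀ i j u → flip i (flip j u) ≡ flip j (flip i u)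
  flip-comm i j u = bits-injective λ k →
    trans (bits-flip-flip i j u k) (trans (toggle-comm (does (k Fin.≟ i)) (does (k Fin.≟ j)) (bits u k))
      (sym (bits-flip-flip j i u k)))

  flip-≢ : ∀ i u → flip i u ≢ u
  flip-≢ i u eq = opposite₂-≢ (bits u i) (trans (sym (bits-flip-≡ i u)) (cong (λ v → bits v i) eq))

  flip-injective : ∀ u {i j} → flip i u ≡ flip j u → i ≡ j
  flip-injective u {i} {j} eq with i Fin.≟ j
  ... | yes i≡j = i≡j
  ... | no i≢j  = contradiction
    (trans (sym (bits-flip-≡ i u)) (trans (cong (λ v → bits v i) eq) (bits-flip-≢ u i≢j)))
    (opposite₂-≢ (bits u i))

  flip-swap : ∀ i {u v} → flip i u ≡ v → u ≡ flip i v
  flip-swap i {u} eq = trans (sym (flip-involutive i u)) (cong (flip i) eq)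

  flip-adjacent : ∀ i u → Graph.Adj (Q n) u (flip i u)
  flip-adjacent i u = i
    , (λ eq → opposite₂-≢ (bits u i) (trans (sym (bits-flip-≡ i u)) (sym eq)))
    , λ j j≢i → sym (bits-flip-≢ u j≢i)

  adjacent⇒flip : ∀ {u v} → Graph.Adj (Q n) u v → ∃[ i ] v ≡ flip i u
  adjacent⇒flip {u} {v} (i , ui≢vi , same) = i , bits-injective agree
    where
    agree : bits v ≗ bits (flip i u)
    agree j with j Fin.≟ i
    ... | yes refl = trans (≢⇒≡-opposite₂ ui≢vi) (sym (bits-flip-≡ i u))
    ... | no j≢i   = trans (sym (same j j≢i)) (sym (bits-flip-≢ u j≢i))

  square : ∀ u {i j} → i ≢ j → Cycle (Q n) 4
  square u {i} {j} i≢j = record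
    { length≥3  = ℕ.s≤s (ℕ.s≤s (ℕ.s≤s ℕ.z≤n))
    ; vertex    = corner
    ; injective = injective-from-< corner distinct
    ; adjacent  = consecutive
    }
    where
    corner : Fin 4 → V
    corner 0F = u
    corner 1F = flip i u
    corner 2F = flip j (flip i u)
    corner 3F = flip j u

    distinct : ∀ k l → k Fin.< l → corner k ≢ corner l
    distinct 0F 1F _ eq = flip-≢ i u (sym eq)
    -- Opposite corners coincide only if the flips in directions i and j agree, hence only if i = j.
    distinct 0F 2F _ eq = i≢j (flip-injective u (flip-swap j (sym eq)))
    distinct 0F 3F _ eq = flip-≢ j u (sym eq)
    distinct 1F 2F _ eq = flip-≢ j (flip i u) (sym eq)
    distinct 1F 3F _ eq = i≢j (flip-injective u eq)
    distinct 2F 3F _ eq = flip-≢ i (flip j u) (trans (flip-comm i j u) eq)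
    distinct (suc _) 0F ()
    distinct 1F 1F (ℕ.s≤s ())
    distinct 2F 1F (ℕ.s≤s ())
    distinct 2F 2F (ℕ.s≤s (ℕ.s≤s ()))
    distinct 3F 1F (ℕ.s≤s ())
    distinct 3F 2F (ℕ.s≤s (ℕ.s≤s ()))
    distinct 3F 3F (ℕ.s≤s (ℕ.s≤s (ℕ.s≤s ())))

    adj-symm : ∀ {v w} → Graph.Adj (Q n) v w → Graph.Adj (Q n) w v
    adj-symm = Graph.symm (Q n)

    consecutive : ∀ k → Graph.Adj (Q n) (corner k) (corner (next k))
    consecutive 0F = flip-adjacent i u
    consecutive 1F = flip-adjacent j (flip i u)
    consecutive 2F = subst (λ w → Graph.Adj (Q n) w (flip j u)) (flip-comm i j u)
      (adj-symm {flip j u} (flip-adjacent i (flip j u)))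
    consecutive 3F = adj-symm {u} (flip-adjacent j u)

  -- A signing that makes every 4-cycle unbalanced

  odd : Fin 2 → Bool
  odd 0F = false
  odd 1F = true

  odd-toggle : ∀ b x → odd (toggle b x) ≡ odd x xor b
  odd-toggle false 0F = refl
  odd-toggle false 1F = refl
  odd-toggle true  0F = refl
  odd-toggle true  1F = refl

  parityBelow : Fin n → V → F₂
  parityBelow i u = sumF₂ λ k → odd (bits u k) whenF₂ does (k Finₚ.<? i)

  xor-when : ∀ x y b → ((x xor y) whenF₂ b) ≡ (x whenF₂ b) xor (y whenF₂ b)
  xor-when x y false = refl
  xor-when x y true  = refl

  when-comm : ∀ b c → (b whenF₂ c) ≡ (c whenF₂ b)
  when-comm false false = refl
  when-comm false true  = refl
  when-comm true  false = refl
  when-comm true  true  = refl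

  parityBelow-flip : ∀ i j u → parityBelow i (flip j u) ≡ parityBelow i u xor does (j Finₚ.<? i)
  parityBelow-flip i j u = begin
    parityBelow i (flip j u)
      ≡⟨ sumF₂-cong (λ k → cong (_whenF₂ does (k Finₚ.<? i))
           (trans (cong odd (bits-flip j u k)) (odd-toggle (does (k Fin.≟ j)) (bits u k)))) ⟩
    (sumF₂ λ k → (odd (bits u k) xor does (k Fin.≟ j)) whenF₂ does (k Finₚ.<? i))
      -- The two Booleans of the new term trade places, so that the indicator of k = j becomes the
      -- selector that `sumF₂-δ` collapses.
      ≡⟨ sumF₂-cong (λ k → trans (xor-when (odd (bits u k)) (does (k Fin.≟ j)) (does (k Finₚ.<? i)))
           (cong ((odd (bits u k) whenF₂ does (k Finₚ.<? i)) xor_) (when-comm (does (k Fin.≟ j)) (does (k Finₚ.<? i))))) ⟩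
    (sumF₂ λ k → (odd (bits u k) whenF₂ does (k Finₚ.<? i)) xor (does (k Finₚ.<? i) whenF₂ does (k Fin.≟ j)))
      ≡⟨ sumF₂-xor (λ k → odd (bits u k) whenF₂ does (k Finₚ.<? i)) (λ k → does (k Finₚ.<? i) whenF₂ does (k Fin.≟ j)) ⟩
    parityBelow i u xor (sumF₂ λ k → does (k Finₚ.<? i) whenF₂ does (k Fin.≟ j))
      ≡⟨ cong (parityBelow i u xor_) (sumF₂-δ (λ k → does (k Finₚ.<? i)) j) ⟩
    parityBelow i u xor does (j Finₚ.<? i) ∎
    where open ≡-Reasoning

  differs : V → V → Fin n → Bool
  differs u v i = not (does (bits u i Fin.≟ bits v i))

  differs-sym : ∀ u v i → differs u v i ≡ differs v u i
  differs-sym u v i = cong not (does-sym (bits u i) (bits v i))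

  differs-flip : ∀ i u j → differs u (flip i u) j ≡ does (j Fin.≟ i)
  differs-flip i u j = trans (cong (λ x → not (does (bits u j Fin.≟ x))) (bits-flip i u j))
    (not-≟-toggle (does (j Fin.≟ i)) (bits u j))
    where
    not-≟-toggle : ∀ b x → not (does (x Fin.≟ toggle b x)) ≡ b
    not-≟-toggle false 0F = refl
    not-≟-toggle false 1F = refl
    not-≟-toggle true  0F = refl
    not-≟-toggle true  1F = refl

  -- The coordinate in which the ends differ sits in an irrelevant field of the edge and cannot be
  -- projected. Summing over all coordinates, weighted by `differs`, recovers it, since an edge
  -- selects exactly one term.
  paritySigning : EdgeVector (Q n)
  paritySigning e = sumF₂ λ i → parityBelow i (Edge.src e) whenF₂ differs (Edge.src e) (Edge.tgt e) i

  -- Only bits strictly below i enter, so both ends of an edge in direction i give the same value.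
  -- Hence the label does not depend on which end is stored as `src`.
  parityBelow-flip-self : ∀ i u → parityBelow i (flip i u) ≡ parityBelow i u
  parityBelow-flip-self i u = trans (parityBelow-flip i i u)
    (trans (cong (parityBelow i u xor_) (dec-false (i Finₚ.<? i) (Finₚ.<-irrefl refl))) (xor-identityʳ _))

  label-paritySigning : ∀ i u → label (Q n) paritySigning u (flip i u) ≡ parityBelow i u
  label-paritySigning i u = trans (label-edge (Q n) paritySigning {u} {flip i u} (flip-adjacent i u)) value
    where
    single : (w : V) (d : Fin n → Bool) → (∀ j → d j ≡ does (j Fin.≟ i)) →
      sumF₂ (λ j → parityBelow j w whenF₂ d j) ≡ parityBelow i w
    single w d d-only = trans (sumF₂-cong λ j → cong (parityBelow j w whenF₂_) (d-only j))
      (sumF₂-δ (λ j → parityBelow j w) i)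

    value : paritySigning (edge (Q n) {u} {flip i u} (flip-adjacent i u)) ≡ parityBelow i u
    value with Finₚ.<-cmp u (flip i u)
    ... | tri< _ _ _  = single u (differs u (flip i u)) (differs-flip i u)
    ... | tri≈ _ eq _ = contradiction (sym eq) (flip-≢ i u)
    ... | tri> _ _ _  = trans (single (flip i u) (differs (flip i u) u) λ j →
            trans (differs-sym (flip i u) u j) (differs-flip i u j)) (parityBelow-flip-self i u)

  -- Bit j is toggled exactly once on the left, since j differs from i and k, so it is the bit
  -- toggled by l. Cancelling it leaves k and i undoing each other. Thus every 4-cycle of the cube
  -- alternates between two directions.
  flip-closed : ∀ u {i j k l} → i ≢ j → j ≢ k →
    flip k (flip j (flip i u)) ≡ flip l u → k ≡ i × l ≡ j
  flip-closed u {i} {j} {k} {l} i≢j j≢k eq with j Fin.≟ l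
  ... | no j≢l = contradiction
    (begin
      opposite (bits u j)                        ≡⟨ cong opposite (bits-flip-≢ u (i≢j ∘ sym)) ⟨
      opposite (bits (flip i u) j)               ≡⟨ bits-flip-≡ j (flip i u) ⟨
      bits (flip j (flip i u)) j                 ≡⟨ bits-flip-≢ (flip j (flip i u)) j≢k ⟨
      bits (flip k (flip j (flip i u))) j        ≡⟨ cong (λ v → bits v j) eq ⟩
      bits (flip l u) j                          ≡⟨ bits-flip-≢ u j≢l ⟩
      bits u j                                   ∎)
    (opposite₂-≢ (bits u j))
    where open ≡-Reasoning
  ... | yes refl = sym (flip-injective u (flip-swap k fixed)) , refl
    where
    fixed : flip k (flip i u) ≡ u
    fixed = trans (flip-swap j (trans (flip-comm j k (flip i u)) eq)) (flip-involutive j u)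

  -- The labels of the two edges in direction i differ by [j < i], those of the two edges in
  -- direction j by [i < j]; as i ≠ j, exactly one of these is 1. The trailing `xor false` is the
  -- empty tail of the sum over four steps.
  paritySigning-flips : ∀ u {i j} → i ≢ j →
    parityBelow i u xor (parityBelow j (flip i u) xor
      (parityBelow i (flip j (flip i u)) xor (parityBelow j u xor false))) ≡ true
  paritySigning-flips u {i} {j} i≢j
    rewrite parityBelow-flip i j (flip i u) | parityBelow-flip-self i u | parityBelow-flip j i u
    with Finₚ.<-cmp i j
  ... | tri≈ _ i≡j _ = contradiction i≡j i≢j
  ... | tri< i<j _ j≮i rewrite dec-true (i Finₚ.<? j) i<j | dec-false (j Finₚ.<? i) j≮i =
    cancel (parityBelow i u) (parityBelow j u)
    where
    cancel : ∀ a b → a xor ((b xor true) xor ((a xor false) xor (b xor false))) ≡ true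
    cancel false false = refl
    cancel false true  = refl
    cancel true  false = refl
    cancel true  true  = refl
  ... | tri> i≮j _ j<i rewrite dec-false (i Finₚ.<? j) i≮j | dec-true (j Finₚ.<? i) j<i =
    cancel (parityBelow i u) (parityBelow j u)
    where
    cancel : ∀ a b → a xor ((b xor false) xor ((a xor true) xor (b xor false))) ≡ true
    cancel false false = refl
    cancel false true  = refl
    cancel true  false = refl
    cancel true  true  = refl

  paritySigning-unbalanced : All4CyclesUnbalanced (Q n) paritySigning
  paritySigning-unbalanced C = trans (dot-cycle (Q n) paritySigning C)
    (unbalanced (adjacent⇒flip {vertex 0F} (adjacent 0F)) (adjacent⇒flip {vertex 1F} (adjacent 1F))
      (adjacent⇒flip {vertex 2F} (adjacent 2F)) (adjacent⇒flip {vertex 3F} (adjacent 3F)))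
    where
    open Cycle C
    ℓ : V → V → F₂
    ℓ = label (Q n) paritySigning

    closed : ∀ {v₀ v₁ v₂ v₃ i j k l} → v₀ ≢ v₂ → v₁ ≢ v₃ →
      v₁ ≡ flip i v₀ → v₂ ≡ flip j v₁ → v₃ ≡ flip k v₂ → v₀ ≡ flip l v₃ →
      ℓ v₀ v₁ xor (ℓ v₁ v₂ xor (ℓ v₂ v₃ xor (ℓ v₃ v₀ xor false))) ≡ true
    closed {u} {i = i} {j} {k} {l} v₀≢v₂ v₁≢v₃ refl refl refl back
      -- Repeating a direction at once would lead back to the vertex visited two steps earlier, so
      -- consecutive directions differ.
      with flip-closed u {i} {j} {k} {l}
             (λ { refl → v₀≢v₂ (sym (flip-involutive i u)) })
             (λ { refl → v₁≢v₃ (sym (flip-involutive j (flip i u))) })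
             (flip-swap l (sym back))
    ... | refl , refl = trans
      (cong₂ _xor_ (label-paritySigning i u) (cong₂ _xor_ (label-paritySigning j (flip i u))
        (cong₂ _xor_ (label-paritySigning i (flip j (flip i u))) (cong (_xor false) last))))
      (paritySigning-flips u λ { refl → v₀≢v₂ (sym (flip-involutive i u)) })
      where
      v₃ : V
      v₃ = flip i (flip j (flip i u))
      last : ℓ v₃ u ≡ parityBelow j u
      last = begin
        ℓ v₃ u                   ≡⟨ cong (ℓ v₃) back ⟩
        ℓ v₃ (flip j v₃)         ≡⟨ label-paritySigning j v₃ ⟩
        parityBelow j v₃         ≡⟨ cong (parityBelow j) (flip-swap j (sym back)) ⟩
        parityBelow j (flip j u) ≡⟨ parityBelow-flip-self j u ⟩
        parityBelow j u          ∎
        where open ≡-Reasoning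

    unbalanced : _ → _ → _ → _ → _
    unbalanced (i , p) (j , q) (k , r) (l , t) =
      closed (λ eq → 0≢2 (injective eq)) (λ eq → 1≢3 (injective eq)) p q r t
      where
      0≢2 : Fin.zero {3} ≢ 2F
      0≢2 ()
      1≢3 : Fin.suc {3} 0F ≢ 3F
      1≢3 ()

-- The square of the signed adjacency matrix as a sum over walks

open module ℤ-sum = SemiringSum ℤₚ.+-*-semiring using ()
  renaming (sum to sumℤ; sum-cong-≗ to sumℤ-cong; ∑-distrib-+ to sumℤ-+; *-distribˡ-sum to *-sumℤ)
open module ℤ-when = Restriction ℤₚ.+-0-commutativeMonoid using ()
  renaming (_when_ to _whenℤ_; sum-ε to sumℤ-0; sum-δ to sumℤ-δ; sum-reindex to sumℤ-reindex)

signedAdjacency-nonadjacent : ∀ G s {u v} → ¬ Graph.Adj G u v → signedAdjacency G s u v ≡ 0ℤ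
signedAdjacency-nonadjacent G s {u} {v} ¬a with Graph.adj? G u v
... | yes a = contradiction a ¬a
... | no _  = refl

*-whenℤ : ∀ x y b → x ℤ.* (y whenℤ b) ≡ (x ℤ.* y whenℤ b)
*-whenℤ x y false = ℤₚ.*-zeroʳ x
*-whenℤ x y true  = refl

+-whenℤ : ∀ x y b → (x whenℤ b) ℤ.+ (y whenℤ b) ≡ (x ℤ.+ y whenℤ b)
+-whenℤ x y false = refl
+-whenℤ x y true  = refl

-- Removing the first row and column together pairs each of their off-diagonal terms with its
-- transpose; these cancel, and the remaining square is the induction hypothesis.
sumℤ-antisymmetric : ∀ {n} (T : Fin n → Fin n → ℤ) c → (∀ i → T i i ≡ c) →
  (∀ i j → i ≢ j → T i j ℤ.+ T j i ≡ 0ℤ) → (sumℤ λ i → sumℤ λ j → T i j) ≡ + n ℤ.* c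
sumℤ-antisymmetric {zero}  T c diagonal antisymmetric = refl
sumℤ-antisymmetric {suc n} T c diagonal antisymmetric = begin
  (T zero zero ℤ.+ sumℤ row) ℤ.+ (sumℤ λ i → column i ℤ.+ inner i)
    ≡⟨ cong (ℤ._+_ (T zero zero ℤ.+ sumℤ row)) (sumℤ-+ column inner) ⟩
  (T zero zero ℤ.+ sumℤ row) ℤ.+ (sumℤ column ℤ.+ sumℤ inner)
    ≡⟨ solve 4 (λ a b c d → (a :+ b) :+ (c :+ d) := (a :+ d) :+ (b :+ c)) refl
         (T zero zero) (sumℤ row) (sumℤ column) (sumℤ inner) ⟩
  (T zero zero ℤ.+ sumℤ inner) ℤ.+ (sumℤ row ℤ.+ sumℤ column)
    ≡⟨ cong₂ ℤ._+_ (cong₂ ℤ._+_ (diagonal zero) rest) (trans (sym (sumℤ-+ row column)) cross) ⟩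
  (c ℤ.+ + n ℤ.* c) ℤ.+ 0ℤ
    ≡⟨ ℤₚ.+-identityʳ _ ⟩
  c ℤ.+ + n ℤ.* c
    ≡⟨ ℤₚ.suc-* (+ n) c ⟨
  + suc n ℤ.* c ∎
  where
  open ≡-Reasoning
  open ℤ-Solver.+-*-Solver
  row column inner : Fin n → ℤ
  row j    = T zero (suc j)
  column i = T (suc i) zero
  inner i  = sumℤ λ j → T (suc i) (suc j)
  rest : sumℤ inner ≡ + n ℤ.* c
  rest = sumℤ-antisymmetric (λ i j → T (suc i) (suc j)) c (diagonal ∘ suc)
    λ i j i≢j → antisymmetric (suc i) (suc j) (i≢j ∘ Finₚ.suc-injective)
  cross : sumℤ (λ i → row i ℤ.+ column i) ≡ 0ℤ
  cross = sumℤ-0 (λ i → row i ℤ.+ column i) λ i → antisymmetric zero (suc i) λ ()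

sign-square : ∀ a → sign a ℤ.* sign a ≡ 1ℤ
sign-square false = refl
sign-square true  = refl

-- An odd label sum means that the four signs multiply to -1, so the product over one side of the
-- square is minus that over the other. The order `d`, `c` reads the second side from the common
-- start.
sign-cancel : ∀ a b c d → a xor (b xor (c xor (d xor false))) ≡ true →
  sign a ℤ.* sign b ℤ.+ sign d ℤ.* sign c ≡ 0ℤ
sign-cancel false false false true  _ = refl
sign-cancel false false true  false _ = refl
sign-cancel false true  false false _ = refl
sign-cancel false true  true  true  _ = refl
sign-cancel true  false false false _ = refl
sign-cancel true  false true  true  _ = refl
sign-cancel true  true  false true  _ = refl
sign-cancel true  true  true  false _ = refl
sign-cancel false false false false ()
sign-cancel false false true  true  ()
sign-cancel false true  false true  ()
sign-cancel false true  true  false ()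
sign-cancel true  false false true  ()
sign-cancel true  false true  false ()
sign-cancel true  true  false false ()
sign-cancel true  true  true  true  ()

module SignedHypercube (n : ℕ) (s : EdgeVector (Q n)) where
  open Hypercube n

  private
    V : Set
    V = Vertex (Q n)

    A : V → V → ℤ
    A = signedAdjacency (Q n) s

    ℓ : V → V → F₂
    ℓ = label (Q n) s

  A-flip : ∀ i u → A u (flip i u) ≡ sign (ℓ u (flip i u))
  A-flip i u = signedAdjacency-adjacent (Q n) s {u} (flip-adjacent i u)

  A-nonflip : ∀ {u v} → (∀ i → v ≢ flip i u) → A u v ≡ 0ℤ
  A-nonflip {u} {v} v≢ = signedAdjacency-nonadjacent (Q n) s {u} λ a →
    let (i , v≡) = adjacent⇒flip {u = u} a in v≢ i v≡

  rowSum : ∀ u (f : V → ℤ) → sumℤ (λ v → A u v ℤ.* f v) ≡ sumℤ (λ i → A u (flip i u) ℤ.* f (flip i u))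
  rowSum u f = sumℤ-reindex (λ i → flip i u) (flip-injective u) (λ v → A u v ℤ.* f v)
    λ v v≢ → cong (ℤ._* f v) (A-nonflip v≢)

  -- Makes the second step of a walk a flip as well, with the prescribed end turned into an
  -- indicator.
  A-entry : ∀ v w → A v w ≡ sumℤ (λ j → A v (flip j v) whenℤ does (flip j v Fin.≟ w))
  A-entry v w = trans (sym (sumℤ-δ (A v) w)) (sumℤ-reindex (λ j → flip j v) (flip-injective v)
    (λ v′ → A v v′ whenℤ does (v′ Fin.≟ w)) λ v′ v′≢ →
      trans (cong (_whenℤ does (v′ Fin.≟ w)) (A-nonflip v′≢)) (ℤ-when.ε-when _))

  -- With the target kept as an indicator, the pairs (i , j) index the walks for every `w` alike,
  -- and exchanging i and j is a symmetry of the index set.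
  walk : V → V → Fin n → Fin n → ℤ
  walk u w i j = A u (flip i u) ℤ.* A (flip i u) (flip j (flip i u)) whenℤ does (flip j (flip i u) Fin.≟ w)

  square-walks : ∀ u w → (A *ᴹ A) u w ≡ sumℤ λ i → sumℤ λ j → walk u w i j
  square-walks u w = trans (rowSum u (λ v → A v w)) (sumℤ-cong extend)
    where
    extend : ∀ i → A u (flip i u) ℤ.* A (flip i u) w ≡ sumℤ (walk u w i)
    extend i = trans (cong (A u v ℤ.*_) (A-entry v w)) (trans (*-sumℤ (A u v) continue)
      (sumℤ-cong λ j → *-whenℤ (A u v) (A v (flip j v)) (does (flip j v Fin.≟ w))))
      where
      v : V
      v = flip i u
      continue : Fin n → ℤ
      continue j = A v (flip j v) whenℤ does (flip j v Fin.≟ w)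

  walk-back : ∀ u w i → walk u w i i ≡ (1ℤ whenℤ does (u Fin.≟ w))
  walk-back u w i = cong₂ _whenℤ_ signs (cong (λ v → does (v Fin.≟ w)) (flip-involutive i u))
    where
    open ≡-Reasoning
    signs : A u (flip i u) ℤ.* A (flip i u) (flip i (flip i u)) ≡ 1ℤ
    signs = begin
      A u (flip i u) ℤ.* A (flip i u) (flip i (flip i u))
        ≡⟨ cong₂ ℤ._*_ (A-flip i u) (A-flip i (flip i u)) ⟩
      sign (ℓ u (flip i u)) ℤ.* sign (ℓ (flip i u) (flip i (flip i u)))
        ≡⟨ cong (λ v → sign (ℓ u (flip i u)) ℤ.* sign (ℓ (flip i u) v)) (flip-involutive i u) ⟩
      sign (ℓ u (flip i u)) ℤ.* sign (ℓ (flip i u) u)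
        ≡⟨ cong (λ x → sign (ℓ u (flip i u)) ℤ.* sign x) (label-sym (Q n) s (flip i u) u) ⟩
      sign (ℓ u (flip i u)) ℤ.* sign (ℓ u (flip i u))
        ≡⟨ sign-square (ℓ u (flip i u)) ⟩
      1ℤ ∎

  walk-cancel : All4CyclesUnbalanced (Q n) s → ∀ u w i j → i ≢ j → walk u w i j ℤ.+ walk u w j i ≡ 0ℤ
  walk-cancel unbalanced u w i j i≢j = begin
    walk u w i j ℤ.+ walk u w j i
      -- Both labels of the second walk are read backwards, in the direction in which `square u i≢j`
      -- runs through these edges.
      ≡⟨ cong (ℤ._+_ (walk u w i j)) (cong₂ _whenℤ_ (cong₂ ℤ._*_ first second) (cong (λ v → does (v Fin.≟ w)) (flip-comm i j u))) ⟩
    walk u w i j ℤ.+ (sign (ℓ (flip j u) u) ℤ.* sign (ℓ (flip j (flip i u)) (flip j u)) whenℤ ends)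
      ≡⟨ +-whenℤ (A u (flip i u) ℤ.* A (flip i u) (flip j (flip i u))) _ ends ⟩
    (A u (flip i u) ℤ.* A (flip i u) (flip j (flip i u)) ℤ.+
      sign (ℓ (flip j u) u) ℤ.* sign (ℓ (flip j (flip i u)) (flip j u)) whenℤ ends)
      ≡⟨ cong (_whenℤ ends) (trans (cong₂ ℤ._+_ (cong₂ ℤ._*_ (A-flip i u) (A-flip j (flip i u))) refl)
           (sign-cancel (ℓ u (flip i u)) (ℓ (flip i u) (flip j (flip i u)))
             (ℓ (flip j (flip i u)) (flip j u)) (ℓ (flip j u) u)
             (trans (sym (dot-cycle (Q n) s (square u i≢j))) (unbalanced (square u i≢j))))) ⟩
    (0ℤ whenℤ ends)
      ≡⟨ ℤ-when.ε-when ends ⟩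
    0ℤ ∎
    where
    open ≡-Reasoning
    ends : Bool
    ends = does (flip j (flip i u) Fin.≟ w)
    first : A u (flip j u) ≡ sign (ℓ (flip j u) u)
    first = trans (A-flip j u) (cong sign (label-sym (Q n) s u (flip j u)))
    second : A (flip j u) (flip i (flip j u)) ≡ sign (ℓ (flip j (flip i u)) (flip j u))
    second = trans (A-flip i (flip j u)) (cong sign
      (trans (label-sym (Q n) s (flip j u) (flip i (flip j u))) (cong (λ v → ℓ v (flip j u)) (flip-comm i j u))))

  square-scalar : All4CyclesUnbalanced (Q n) s → ∀ u w → (A *ᴹ A) u w ≡ scalar (+ n) u w
  square-scalar unbalanced u w = trans (square-walks u w)
    (trans (sumℤ-antisymmetric (walk u w) _ (walk-back u w) (walk-cancel unbalanced u w)) (n*δ (does (u Fin.≟ w))))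
    where
    n*δ : ∀ b → + n ℤ.* (1ℤ whenℤ b) ≡ (if b then + n else 0ℤ)
    n*δ false = ℤₚ.*-zeroʳ (+ n)
    n*δ true  = ℤₚ.*-identityʳ (+ n)

-- The embedding of the integers into the rationals

open module ℚ-sum = SemiringSum (CommutativeRing.semiring ℚₚ.+-*-commutativeRing) using ()
  renaming (sum to sumℚ; sum-cong-≗ to sumℚ-cong; ∑-distrib-+ to sumℚ-+; ∑-comm to sumℚ-comm;
            *-distribˡ-sum to *-sumℚ; *-distribʳ-sum to sumℚ-*)
open module ℚ-when = Restriction ℚₚ.+-0-commutativeMonoid using ()
  renaming (_when_ to _whenℚ_; sum-δ to sumℚ-δ)

ι : ℤ → ℚ
ι z = z ℚ./ 1

-- `ι` normalises its fraction, which blocks computation; the laws of `ι` are therefore checked on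
-- unnormalised fractions with denominator 1.
toℚᵘ-ι : ∀ z → ℚ.toℚᵘ (ι z) ℚᵘ.≃ mkℚᵘ z 0
toℚᵘ-ι z = ℚₚ.toℚᵘ-fromℚᵘ (mkℚᵘ z 0)

ι-+ : ∀ a b → ι (a ℤ.+ b) ≡ ι a ℚ.+ ι b
ι-+ a b = ℚₚ.toℚᵘ-injective (begin
  ℚ.toℚᵘ (ι (a ℤ.+ b))               ≈⟨ toℚᵘ-ι (a ℤ.+ b) ⟩
  mkℚᵘ (a ℤ.+ b) 0                   ≈⟨ ℚᵘ.*≡* (cong (ℤ._* 1ℤ) (cong₂ ℤ._+_ (sym (ℤₚ.*-identityʳ a)) (sym (ℤₚ.*-identityʳ b)))) ⟩
  mkℚᵘ a 0 ℚᵘ.+ mkℚᵘ b 0             ≈⟨ ℚᵘₚ.+-cong (toℚᵘ-ι a) (toℚᵘ-ι b) ⟨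
  ℚ.toℚᵘ (ι a) ℚᵘ.+ ℚ.toℚᵘ (ι b)     ≈⟨ ℚₚ.toℚᵘ-homo-+ (ι a) (ι b) ⟨
  ℚ.toℚᵘ (ι a ℚ.+ ι b)               ∎)
  where open ℚᵘₚ.≃-Reasoning

ι-* : ∀ a b → ι (a ℤ.* b) ≡ ι a ℚ.* ι b
ι-* a b = ℚₚ.toℚᵘ-injective (begin
  ℚ.toℚᵘ (ι (a ℤ.* b))               ≈⟨ toℚᵘ-ι (a ℤ.* b) ⟩
  mkℚᵘ a 0 ℚᵘ.* mkℚᵘ b 0             ≈⟨ ℚᵘₚ.*-cong (toℚᵘ-ι a) (toℚᵘ-ι b) ⟨
  ℚ.toℚᵘ (ι a) ℚᵘ.* ℚ.toℚᵘ (ι b)     ≈⟨ ℚₚ.toℚᵘ-homo-* (ι a) (ι b) ⟨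
  ℚ.toℚᵘ (ι a ℚ.* ι b)               ∎)
  where open ℚᵘₚ.≃-Reasoning

ι-mono-≤ : ∀ {a b} → a ℤ.≤ b → ι a ℚ.≤ ι b
ι-mono-≤ {a} {b} a≤b = ℚₚ.toℚᵘ-cancel-≤ (ℚᵘₚ.≤-respˡ-≃ (ℚᵘₚ.≃-sym (toℚᵘ-ι a))
  (ℚᵘₚ.≤-respʳ-≃ (ℚᵘₚ.≃-sym (toℚᵘ-ι b)) (ℚᵘ.*≤* (ℤₚ.*-monoʳ-≤-nonNeg 1ℤ a≤b))))

ι-mono-< : ∀ {a b} → a ℤ.< b → ι a ℚ.< ι b
ι-mono-< {a} {b} a<b = ℚₚ.toℚᵘ-cancel-< (ℚᵘₚ.<-respˡ-≃ (ℚᵘₚ.≃-sym (toℚᵘ-ι a))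
  (ℚᵘₚ.<-respʳ-≃ (ℚᵘₚ.≃-sym (toℚᵘ-ι b)) (ℚᵘ.*<* (ℤₚ.*-monoʳ-<-pos 1ℤ a<b))))

ι-sum : ∀ {n} (f : Fin n → ℤ) → ι (sumℤ f) ≡ sumℚ (ι ∘ f)
ι-sum {zero}  f = refl
ι-sum {suc n} f = trans (ι-+ (f zero) (sumℤ (f ∘ suc))) (cong (ℚ._+_ (ι (f zero))) (ι-sum (f ∘ suc)))

-- Null sequences

Null : (ℕ → ℚ) → Set
Null f = ∀ ε → 0ℚ ℚ.< ε → ∃[ N ] (∀ n → N ℕ.≤ n → ℚ.∣ f n ∣ ℚ.< ε)

null-resp : ∀ {f g : ℕ → ℚ} → f ≗ g → Null f → Null g
null-resp f≗g f→0 ε 0<ε with f→0 ε 0<ε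
... | N , h = N , λ n n≥ → subst (λ x → ℚ.∣ x ∣ ℚ.< ε) (f≗g n) (h n n≥)

null-0 : Null (λ _ → 0ℚ)
null-0 ε 0<ε = 0 , λ _ _ → 0<ε

null-+ : ∀ {f g : ℕ → ℚ} → Null f → Null g → Null (λ n → f n ℚ.+ g n)
null-+ {f} {g} f→0 g→0 ε 0<ε with f→0 (½ ℚ.* ε) (half-pos 0<ε) | g→0 (½ ℚ.* ε) (half-pos 0<ε)
... | M , hf | N , hg = M ℕ.⊔ N , λ n n≥ → begin-strict
  ℚ.∣ f n ℚ.+ g n ∣           ≤⟨ ℚₚ.∣p+q∣≤∣p∣+∣q∣ (f n) (g n) ⟩
  ℚ.∣ f n ∣ ℚ.+ ℚ.∣ g n ∣     <⟨ ℚₚ.+-mono-< (hf n (ℕₚ.m⊔n≤o⇒m≤o M N n≥)) (hg n (ℕₚ.m⊔n≤o⇒n≤o M N n≥)) ⟩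
  ½ ℚ.* ε ℚ.+ ½ ℚ.* ε         ≡⟨ half+half ε ⟩
  ε                           ∎
  where open ℚₚ.≤-Reasoning

-- The tolerance for `g` is scaled by c. With c = 1 this is comparison, with c = 1/B it gives
-- multiplication by a bounded sequence, and with c = η² it makes an eigenvector vanish when its
-- eigenvalue is too large.
null-cancel : ∀ {f g : ℕ → ℚ} c → 0ℚ ℚ.< c → ∃[ N ] (∀ n → N ℕ.≤ n → c ℚ.* ℚ.∣ f n ∣ ℚ.≤ ℚ.∣ g n ∣) → Null g → Null f
null-cancel c 0<c (M , dominated) g→0 ε 0<ε
  with g→0 (c ℚ.* ε) (ℚₚ.positive⁻¹ _ {{ℚₚ.pos*pos⇒pos c {{ℚ.positive 0<c}} ε {{ℚ.positive 0<ε}}}})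
... | N , hg = M ℕ.⊔ N , λ n n≥ → ℚₚ.*-cancelˡ-<-nonNeg c {{ℚ.nonNegative (ℚₚ.<⇒≤ 0<c)}}
  (ℚₚ.≤-<-trans (dominated n (ℕₚ.m⊔n≤o⇒m≤o M N n≥)) (hg n (ℕₚ.m⊔n≤o⇒n≤o M N n≥)))

null-dominated : ∀ {f g : ℕ → ℚ} → (∀ n → ℚ.∣ f n ∣ ℚ.≤ ℚ.∣ g n ∣) → Null g → Null f
null-dominated {f} {g} f≤g = null-cancel {f} {g} 1ℚ (ℚₚ.positive⁻¹ 1ℚ)
  (0 , λ n _ → subst (ℚ._≤ ℚ.∣ g n ∣) (sym (ℚₚ.*-identityˡ ℚ.∣ f n ∣)) (f≤g n))

null-bounded-* : ∀ {f g : ℕ → ℚ} B → 0ℚ ℚ.< B → ∃[ N ] (∀ n → N ℕ.≤ n → ℚ.∣ g n ∣ ℚ.< B) →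
  Null f → Null (λ n → g n ℚ.* f n)
null-bounded-* {f} {g} B 0<B (N , bounded) =
  null-cancel {λ n → g n ℚ.* f n} {f} B⁻¹ (ℚₚ.positive⁻¹ B⁻¹ {{B⁻¹-positive}}) (N , dominated)
  where
  open ℚₚ.≤-Reasoning
  B-nonZero : ℚ.NonZero B
  B-nonZero = ℚₚ.pos⇒nonZero B {{ℚ.positive 0<B}}
  B⁻¹ : ℚ
  B⁻¹ = (ℚ.1/ B) {{B-nonZero}}
  B⁻¹-positive : ℚ.Positive B⁻¹
  B⁻¹-positive = ℚₚ.1/pos⇒pos B {{ℚ.positive 0<B}}
  dominated : ∀ n → N ℕ.≤ n → B⁻¹ ℚ.* ℚ.∣ g n ℚ.* f n ∣ ℚ.≤ ℚ.∣ f n ∣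
  dominated n n≥ = begin
    B⁻¹ ℚ.* ℚ.∣ g n ℚ.* f n ∣
      ≤⟨ ℚₚ.*-monoˡ-≤-nonNeg B⁻¹ {{ℚₚ.pos⇒nonNeg B⁻¹ {{B⁻¹-positive}}}}
           (*-mono-≤-bounds (g n) (f n) {B} {ℚ.∣ f n ∣} (ℚₚ.<⇒≤ (bounded n n≥)) (ℚₚ.≤-refl {ℚ.∣ f n ∣})) ⟩
    B⁻¹ ℚ.* (B ℚ.* ℚ.∣ f n ∣)
      ≡⟨ ℚₚ.*-assoc B⁻¹ B ℚ.∣ f n ∣ ⟨
    (B⁻¹ ℚ.* B) ℚ.* ℚ.∣ f n ∣
      ≡⟨ cong (ℚ._* ℚ.∣ f n ∣) (ℚₚ.*-inverseˡ B {{B-nonZero}}) ⟩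
    1ℚ ℚ.* ℚ.∣ f n ∣
      ≡⟨ ℚₚ.*-identityˡ ℚ.∣ f n ∣ ⟩
    ℚ.∣ f n ∣ ∎

null-* : ∀ {f} x → Null f → Null (λ n → seq x n ℚ.* f n)
null-* {f} x = null-bounded-* {f} {seq x} (proj₁ bound) (proj₁ (proj₂ bound)) (proj₂ (proj₂ bound))
  where bound = eventually-bounded x

null-sum : ∀ {m} (f : Fin m → ℕ → ℚ) → (∀ i → Null (f i)) → Null (λ n → sumℚ λ i → f i n)
null-sum {zero}  f f→0 = null-0
null-sum {suc m} f f→0 = null-+ (f→0 zero) (null-sum (f ∘ suc) (f→0 ∘ suc))

-- Order and absolute value of rationals

p≤q⇒0≤q-p : ∀ {p q} → p ℚ.≤ q → 0ℚ ℚ.≤ q ℚ.- p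
p≤q⇒0≤q-p {p} {q} p≤q = subst (ℚ._≤ q ℚ.- p) (ℚₚ.+-inverseʳ p) (ℚₚ.+-monoˡ-≤ (ℚ.- p) p≤q)

*-0≤ : ∀ {p q} → 0ℚ ℚ.≤ p → 0ℚ ℚ.≤ q → 0ℚ ℚ.≤ p ℚ.* q
*-0≤ {p} {q} 0≤p 0≤q = ℚₚ.nonNegative⁻¹ (p ℚ.* q)
  {{ℚₚ.nonNeg*nonNeg⇒nonNeg p {{ℚ.nonNegative 0≤p}} q {{ℚ.nonNegative 0≤q}}}}

square-mono-≤ : ∀ {p q} → 0ℚ ℚ.≤ p → p ℚ.≤ q → p ℚ.* p ℚ.≤ q ℚ.* q
square-mono-≤ {p} {q} 0≤p p≤q = ℚₚ.≤-trans
  (ℚₚ.*-monoˡ-≤-nonNeg p {{ℚ.nonNegative 0≤p}} p≤q)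
  (ℚₚ.*-monoʳ-≤-nonNeg q {{ℚ.nonNegative (ℚₚ.≤-trans 0≤p p≤q)}} p≤q)

square-cancel-< : ∀ {p q} → 0ℚ ℚ.≤ q → p ℚ.* p ℚ.< q ℚ.* q → p ℚ.< q
square-cancel-< 0≤q p²<q² = ℚₚ.≰⇒> λ q≤p → ℚₚ.<-irrefl refl (ℚₚ.<-≤-trans p²<q² (square-mono-≤ 0≤q q≤p))

∣p∣²≡p² : ∀ p → ℚ.∣ p ∣ ℚ.* ℚ.∣ p ∣ ≡ p ℚ.* p
∣p∣²≡p² p with ℚₚ.∣p∣≡p∨∣p∣≡-p p
... | inj₁ eq = cong₂ ℚ._*_ eq eq
... | inj₂ eq = trans (cong₂ ℚ._*_ eq eq) (solve 1 (λ a → (:- a) :* (:- a) := a :* a) refl p)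
  where open +-*-Solver

∣p-q∣<ε : ∀ {p q ε} → p ℚ.< q ℚ.+ ε → q ℚ.< p ℚ.+ ε → ℚ.∣ p ℚ.- q ∣ ℚ.< ε
∣p-q∣<ε {p} {q} {ε} p<q+ε q<p+ε with ℚₚ.∣p∣≡p∨∣p∣≡-p (p ℚ.- q)
... | inj₁ eq = subst₂ ℚ._<_ (sym eq) (solve 2 (λ b e → (b :+ e) :- b := e) refl q ε)
      (ℚₚ.+-monoˡ-< (ℚ.- q) p<q+ε)
  where open +-*-Solver
... | inj₂ eq = subst₂ ℚ._<_ (trans (solve 2 (λ a b → b :- a := :- (a :- b)) refl p q) (sym eq))
      (solve 2 (λ b e → (b :+ e) :- b := e) refl p ε) (ℚₚ.+-monoˡ-< (ℚ.- p) q<p+ε)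
  where open +-*-Solver

p≤∣p∣ : ∀ p → p ℚ.≤ ℚ.∣ p ∣
p≤∣p∣ p with ℚₚ.≤-total 0ℚ p
... | inj₁ 0≤p = ℚₚ.≤-reflexive (sym (ℚₚ.0≤p⇒∣p∣≡p 0≤p))
... | inj₂ p≤0 = ℚₚ.≤-trans p≤0 (ℚₚ.0≤∣p∣ p)

∣p-q∣<ε⇒p<q+ε : ∀ {p q ε} → ℚ.∣ p ℚ.- q ∣ ℚ.< ε → p ℚ.< q ℚ.+ ε
∣p-q∣<ε⇒p<q+ε {p} {q} {ε} h = subst₂ ℚ._<_ (solve 2 (λ a b → (a :- b) :+ b := a) refl p q) (ℚₚ.+-comm ε q)
  (ℚₚ.+-monoˡ-< q (ℚₚ.≤-<-trans (p≤∣p∣ (p ℚ.- q)) h))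
  where open +-*-Solver

-- The square root of a natural number as a Cauchy sequence

isqrt : ∀ n → ∃[ m ] (m ℕ.* m ℕ.≤ n × n ℕ.< suc m ℕ.* suc m)
isqrt zero    = 0 , ℕ.z≤n , ℕ.s≤s ℕ.z≤n
isqrt (suc n) with isqrt n
... | m , m²≤n , n<m′² with suc m ℕ.* suc m ℕ.≤? suc n
-- The root grows by one at most: n < (m+1)² gives n + 1 ≤ (m+1)² < (m+2)².
...   | yes m′²≤n′ = suc m , m′²≤n′ , ℕₚ.≤-<-trans n<m′² (ℕₚ.*-mono-< (ℕₚ.n<1+n (suc m)) (ℕₚ.n<1+n (suc m)))
...   | no m′²≰n′  = m , ℕₚ.m≤n⇒m≤1+n m²≤n , ℕₚ.≰⇒> m′²≰n′

1/suc : ℕ → ℚ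
1/suc k = 1ℤ ℚ./ suc k

toℚᵘ-1/suc : ∀ k → ℚ.toℚᵘ (1/suc k) ℚᵘ.≃ mkℚᵘ 1ℤ k
toℚᵘ-1/suc k = ℚₚ.toℚᵘ-fromℚᵘ (mkℚᵘ 1ℤ k)

0<1/suc : ∀ k → 0ℚ ℚ.< 1/suc k
0<1/suc k = ℚₚ.positive⁻¹ (1/suc k) {{ℚₚ.normalize-pos 1 (suc k)}}

suc*1/suc : ∀ k → ι (+ suc k) ℚ.* 1/suc k ≡ 1ℚ
suc*1/suc k = ℚₚ.toℚᵘ-injective (begin
  ℚ.toℚᵘ (ι (+ suc k) ℚ.* 1/suc k)          ≈⟨ ℚₚ.toℚᵘ-homo-* (ι (+ suc k)) (1/suc k) ⟩
  ℚ.toℚᵘ (ι (+ suc k)) ℚᵘ.* ℚ.toℚᵘ (1/suc k) ≈⟨ ℚᵘₚ.*-cong (toℚᵘ-ι (+ suc k)) (toℚᵘ-1/suc k) ⟩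
  mkℚᵘ (+ suc k) 0 ℚᵘ.* mkℚᵘ 1ℤ k           ≈⟨ ℚᵘ.*≡* (trans (trans (ℤₚ.*-identityʳ _) (ℤₚ.*-identityʳ (+ suc k)))
                                                  (sym (trans (ℤₚ.*-identityˡ _) (cong (λ m → + suc m) (ℕₚ.+-identityʳ k))))) ⟩
  ℚ.toℚᵘ 1ℚ                                 ∎)
  where open ℚᵘₚ.≃-Reasoning

-- For ε = (p+1)/(q+1) the index q + 1 suffices, since then q + 1 < k + 1 ≤ (p+1)(k+1).
1/suc-eventually-< : ∀ {ε} → 0ℚ ℚ.< ε → ∃[ N ] (∀ k → N ℕ.≤ k → 1/suc k ℚ.< ε)
1/suc-eventually-< {ε@(ℚ.mkℚ (+ suc p) q _)} _ = suc q , λ k q<k → ℚₚ.toℚᵘ-cancel-<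
  (ℚᵘₚ.<-respˡ-≃ (ℚᵘₚ.≃-sym (toℚᵘ-1/suc k)) (ℚᵘ.*<* (ℤ.+<+ (begin-strict
    1 ℕ.* suc q      ≡⟨ ℕₚ.*-identityˡ (suc q) ⟩
    suc q            ≤⟨ q<k ⟩
    k                <⟨ ℕₚ.n<1+n k ⟩
    suc k            ≤⟨ ℕₚ.m≤m+n (suc k) (p ℕ.* suc k) ⟩
    suc p ℕ.* suc k  ∎))))
  where open ℕₚ.≤-Reasoning
1/suc-eventually-< {ℚ.mkℚ (+ zero) q _}   (ℚ.*<* (ℤ.+<+ ()))
1/suc-eventually-< {ℚ.mkℚ ℤ.-[1+ p ] q _} (ℚ.*<* ())

module SquareRoot (n : ℕ) where

  numerator : ℕ → ℕ
  numerator k = proj₁ (isqrt (n ℕ.* (suc k ℕ.* suc k)))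

  -- √n rounded down to a multiple of 1/(k+1), because `numerator k` is the integer root of n(k+1)².
  approx : ℕ → ℚ
  approx k = ι (+ numerator k) ℚ.* 1/suc k

  0≤approx : ∀ k → 0ℚ ℚ.≤ approx k
  0≤approx k = *-0≤ {ι (+ numerator k)} {1/suc k} (ι-mono-≤ {0ℤ} {+ numerator k} (ℤ.+≤+ ℕ.z≤n)) (ℚₚ.<⇒≤ (0<1/suc k))

  private
    0<1/suc² : ∀ k → ℚ.Positive (1/suc k ℚ.* 1/suc k)
    0<1/suc² k = ℚₚ.pos*pos⇒pos (1/suc k) {{ℚ.positive (0<1/suc k)}} (1/suc k) {{ℚ.positive (0<1/suc k)}}

    ι-scale : ∀ a b k → ι (+ (a ℕ.* b)) ℚ.* (1/suc k ℚ.* 1/suc k) ≡ (ι (+ a) ℚ.* 1/suc k) ℚ.* (ι (+ b) ℚ.* 1/suc k)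
    ι-scale a b k = trans
      (cong (ℚ._* (1/suc k ℚ.* 1/suc k)) (trans (cong ι (ℤₚ.pos-* a b)) (ι-* (+ a) (+ b))))
      (solve 3 (λ x y d → (x :* y) :* (d :* d) := (x :* d) :* (y :* d)) refl (ι (+ a)) (ι (+ b)) (1/suc k))
      where open +-*-Solver

    ι-radicand : ∀ k → ι (+ (n ℕ.* (suc k ℕ.* suc k))) ℚ.* (1/suc k ℚ.* 1/suc k) ≡ ι (+ n)
    ι-radicand k = begin
      ι (+ (n ℕ.* (K ℕ.* K))) ℚ.* (1/suc k ℚ.* 1/suc k)
        ≡⟨ cong (ℚ._* (1/suc k ℚ.* 1/suc k)) (trans (cong ι (ℤₚ.pos-* n (K ℕ.* K))) (ι-* (+ n) (+ (K ℕ.* K)))) ⟩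
      (ι (+ n) ℚ.* ι (+ (K ℕ.* K))) ℚ.* (1/suc k ℚ.* 1/suc k)
        ≡⟨ ℚₚ.*-assoc (ι (+ n)) (ι (+ (K ℕ.* K))) (1/suc k ℚ.* 1/suc k) ⟩
      ι (+ n) ℚ.* (ι (+ (K ℕ.* K)) ℚ.* (1/suc k ℚ.* 1/suc k))
        ≡⟨ cong (ι (+ n) ℚ.*_) (trans (ι-scale K K k) (cong₂ ℚ._*_ (suc*1/suc k) (suc*1/suc k))) ⟩
      ι (+ n) ℚ.* 1ℚ
        ≡⟨ ℚₚ.*-identityʳ (ι (+ n)) ⟩
      ι (+ n) ∎
      where
      open ≡-Reasoning
      K : ℕ
      K = suc k

    suc-numerator : ∀ k → ι (+ suc (numerator k)) ℚ.* 1/suc k ≡ approx k ℚ.+ 1/suc k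
    suc-numerator k = trans (cong (ℚ._* 1/suc k) (ι-+ 1ℤ (+ numerator k)))
      (solve 2 (λ x d → (con 1ℚ :+ x) :* d := x :* d :+ d) refl (ι (+ numerator k)) (1/suc k))
      where open +-*-Solver

  approx²≤n : ∀ k → approx k ℚ.* approx k ℚ.≤ ι (+ n)
  approx²≤n k = subst₂ ℚ._≤_ (ι-scale (numerator k) (numerator k) k) (ι-radicand k)
    (ℚₚ.*-monoʳ-≤-nonNeg (1/suc k ℚ.* 1/suc k) {{ℚₚ.pos⇒nonNeg (1/suc k ℚ.* 1/suc k) {{0<1/suc² k}}}}
      (ι-mono-≤ (ℤ.+≤+ (proj₁ (proj₂ (isqrt (n ℕ.* (suc k ℕ.* suc k))))))))

  n<approx+² : ∀ k → ι (+ n) ℚ.< (approx k ℚ.+ 1/suc k) ℚ.* (approx k ℚ.+ 1/suc k)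
  n<approx+² k = subst₂ ℚ._<_ (ι-radicand k)
    (trans (ι-scale (suc (numerator k)) (suc (numerator k)) k) (cong₂ ℚ._*_ (suc-numerator k) (suc-numerator k)))
    (ℚₚ.*-monoˡ-<-pos (1/suc k ℚ.* 1/suc k) {{0<1/suc² k}}
      (ι-mono-< (ℤ.+<+ (proj₂ (proj₂ (isqrt (n ℕ.* (suc k ℕ.* suc k))))))))

  -- Both squares are compared with n, so the bound holds for every pair j, k; used in both
  -- directions it gives the Cauchy property.
  approx-close : ∀ j k → approx j ℚ.< approx k ℚ.+ 1/suc k
  approx-close j k = square-cancel-< (ℚₚ.+-mono-≤ (0≤approx k) (ℚₚ.<⇒≤ (0<1/suc k)))
    (ℚₚ.≤-<-trans (approx²≤n j) (n<approx+² k))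

  approx-cauchy : IsCauchy approx
  approx-cauchy ε 0<ε with 1/suc-eventually-< 0<ε
  ... | N , small = N , λ j k j≥ k≥ → ∣p-q∣<ε {approx j} {approx k}
    (ℚₚ.<-trans (approx-close j k) (ℚₚ.+-monoʳ-< (approx k) (small k k≥)))
    (ℚₚ.<-trans (approx-close k j) (ℚₚ.+-monoʳ-< (approx j) (small j j≥)))

  √ : ℝ
  √ = mkℝ approx approx-cauchy

  private
    1/suc-null : Null 1/suc
    1/suc-null ε 0<ε with 1/suc-eventually-< 0<ε
    ... | N , small = N , λ k k≥ → subst (ℚ._< ε) (sym (ℚₚ.0≤p⇒∣p∣≡p (ℚₚ.<⇒≤ (0<1/suc k)))) (small k k≥)

    1/suc≤1 : ∀ k → 1/suc k ℚ.≤ 1ℚ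
    1/suc≤1 k = subst₂ ℚ._≤_ (ℚₚ.*-identityˡ (1/suc k)) (suc*1/suc k)
      (ℚₚ.*-monoʳ-≤-nonNeg (1/suc k) {{ℚ.nonNegative (ℚₚ.<⇒≤ (0<1/suc k))}}
        (ι-mono-≤ {1ℤ} {+ suc k} (ℤ.+≤+ (ℕ.s≤s ℕ.z≤n))))

    -- Comes from (a + d)² = a² + 2ad + d² with d² replaced by the larger d, as d ≤ 1. Each summand
    -- is then d or d times a Cauchy sequence.
    error : ℕ → ℚ
    error k = (approx k ℚ.* 1/suc k ℚ.+ approx k ℚ.* 1/suc k) ℚ.+ 1/suc k

    error-null : Null error
    error-null = null-+ (null-+ approx*-null approx*-null) 1/suc-null
      where
      approx*-null : Null (λ k → approx k ℚ.* 1/suc k)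
      approx*-null = null-* √ 1/suc-null

    approx²-close : ∀ k → ι (+ n) ℚ.< approx k ℚ.* approx k ℚ.+ error k
    approx²-close k = begin-strict
      ι (+ n)
        <⟨ n<approx+² k ⟩
      (a ℚ.+ d) ℚ.* (a ℚ.+ d)
        ≡⟨ solve 2 (λ a d → (a :+ d) :* (a :+ d) := (a :* a :+ (a :* d :+ a :* d)) :+ d :* d) refl a d ⟩
      (a ℚ.* a ℚ.+ (a ℚ.* d ℚ.+ a ℚ.* d)) ℚ.+ d ℚ.* d
        ≤⟨ ℚₚ.+-monoʳ-≤ (a ℚ.* a ℚ.+ (a ℚ.* d ℚ.+ a ℚ.* d))
             (ℚₚ.*-monoˡ-≤-nonNeg d {{ℚ.nonNegative (ℚₚ.<⇒≤ (0<1/suc k))}} (1/suc≤1 k)) ⟩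
      (a ℚ.* a ℚ.+ (a ℚ.* d ℚ.+ a ℚ.* d)) ℚ.+ d ℚ.* 1ℚ
        ≡⟨ solve 2 (λ a d → (a :* a :+ (a :* d :+ a :* d)) :+ d :* con 1ℚ := a :* a :+ ((a :* d :+ a :* d) :+ d)) refl a d ⟩
      a ℚ.* a ℚ.+ error k ∎
      where
      open ℚₚ.≤-Reasoning
      open +-*-Solver
      a = approx k
      d = 1/suc k

  √-square : Null (λ k → ι (+ n) ℚ.- approx k ℚ.* approx k)
  √-square = null-dominated {g = error} dominated error-null
    where
    open +-*-Solver
    dominated : ∀ k → ℚ.∣ ι (+ n) ℚ.- approx k ℚ.* approx k ∣ ℚ.≤ ℚ.∣ error k ∣
    dominated k = begin
      ℚ.∣ ι (+ n) ℚ.- a² ∣           ≡⟨ ℚₚ.0≤p⇒∣p∣≡p (p≤q⇒0≤q-p (approx²≤n k)) ⟩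
      ι (+ n) ℚ.- a²                 ≤⟨ ℚₚ.+-monoˡ-≤ (ℚ.- a²) (ℚₚ.<⇒≤ (approx²-close k)) ⟩
      (a² ℚ.+ error k) ℚ.- a²        ≡⟨ solve 2 (λ a e → (a :+ e) :- a := e) refl a² (error k) ⟩
      error k                        ≤⟨ p≤∣p∣ (error k) ⟩
      ℚ.∣ error k ∣                  ∎
      where
      open ℚₚ.≤-Reasoning
      a² = approx k ℚ.* approx k

  √-isSqrt : IsSqrt √ n
  √-isSqrt = nonNegative , square
    where
    nonNegative : fromℤ 0ℤ ≤ √
    nonNegative ε 0<ε = 0 , λ k _ → ℚₚ.≤-<-trans (0≤approx k)
      (subst (ℚ._< approx k ℚ.+ ε) (ℚₚ.+-identityʳ (approx k)) (ℚₚ.+-monoʳ-< (approx k) 0<ε))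
    square : √ * √ ≈ fromℤ (+ n)
    square ε 0<ε = proj₁ (√-square ε 0<ε) , λ k k≥ →
      subst (ℚ._< ε) (∣p-q∣≡∣q-p∣ (ι (+ n)) (approx k ℚ.* approx k)) (proj₂ (√-square ε 0<ε) k k≥)

-- Eigenvalues and the spectral radius when A² = nI

seq-sum : ∀ {m} (x : Fin m → ℝ) k → seq (sumℝ x) k ≡ sumℚ λ i → seq (x i) k
seq-sum {zero}  x k = refl
seq-sum {suc m} x k = cong (ℚ._+_ (seq (x zero) k)) (seq-sum (x ∘ suc) k)

-- The constructive substitute for comparing two reals: a rational comparison at the index N
-- decides. Passing between N and a later k costs δ = ε/8 for each sequence, η = 2δ in all. Around
-- the threshold ε/2 = 2η this leaves either an excess below 3η < ε or one above η.
eventually-<+ε⊎apart : ∀ x r ε → 0ℚ ℚ.< ε →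
  ∃[ N ] (∀ k → N ℕ.≤ k → seq x k ℚ.< seq r k ℚ.+ ε) ⊎
  ∃[ N ] ∃[ η ] (0ℚ ℚ.< η × (∀ k → N ℕ.≤ k → seq r k ℚ.+ η ℚ.< seq x k))
eventually-<+ε⊎apart x r ε 0<ε = decide (seq x N ℚ.<? seq r N ℚ.+ ½ ℚ.* ε)
  where
  open +-*-Solver
  η δ : ℚ
  η = ½ ℚ.* (½ ℚ.* ε)
  δ = ½ ℚ.* η
  0<η : 0ℚ ℚ.< η
  0<η = half-pos (half-pos 0<ε)
  0<δ : 0ℚ ℚ.< δ
  0<δ = half-pos 0<η
  Nx = proj₁ (cauchy x δ 0<δ)
  Nr = proj₁ (cauchy r δ 0<δ)
  N = Nx ℕ.⊔ Nr
  close-x : ∀ {i j} → N ℕ.≤ i → N ℕ.≤ j → seq x i ℚ.< seq x j ℚ.+ δ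
  close-x {i} {j} i≥ j≥ = ∣p-q∣<ε⇒p<q+ε (proj₂ (cauchy x δ 0<δ) i j (ℕₚ.m⊔n≤o⇒m≤o Nx Nr i≥) (ℕₚ.m⊔n≤o⇒m≤o Nx Nr j≥))
  close-r : ∀ {i j} → N ℕ.≤ i → N ℕ.≤ j → seq r i ℚ.< seq r j ℚ.+ δ
  close-r {i} {j} i≥ j≥ = ∣p-q∣<ε⇒p<q+ε (proj₂ (cauchy r δ 0<δ) i j (ℕₚ.m⊔n≤o⇒n≤o Nx Nr i≥) (ℕₚ.m⊔n≤o⇒n≤o Nx Nr j≥))

  decide : Dec (seq x N ℚ.< seq r N ℚ.+ ½ ℚ.* ε) → _
  decide (yes x<) = inj₁ (N , λ k k≥ → begin-strict
    seq x k                                   <⟨ close-x k≥ ℕₚ.≤-refl ⟩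
    seq x N ℚ.+ δ                             <⟨ ℚₚ.+-monoˡ-< δ x< ⟩
    (seq r N ℚ.+ ½ ℚ.* ε) ℚ.+ δ               <⟨ ℚₚ.+-monoˡ-< δ (ℚₚ.+-monoˡ-< (½ ℚ.* ε) (close-r ℕₚ.≤-refl k≥)) ⟩
    ((seq r k ℚ.+ δ) ℚ.+ ½ ℚ.* ε) ℚ.+ δ       ≡⟨ solve 3 (λ a d e → ((a :+ d) :+ e) :+ d := a :+ ((d :+ d) :+ e)) refl (seq r k) δ (½ ℚ.* ε) ⟩
    seq r k ℚ.+ ((δ ℚ.+ δ) ℚ.+ ½ ℚ.* ε)       ≡⟨ cong (λ y → seq r k ℚ.+ (y ℚ.+ ½ ℚ.* ε)) (half+half η) ⟩
    seq r k ℚ.+ (η ℚ.+ ½ ℚ.* ε)               ≡⟨ cong (seq r k ℚ.+_) (ℚₚ.+-identityˡ (η ℚ.+ ½ ℚ.* ε)) ⟨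
    seq r k ℚ.+ (0ℚ ℚ.+ (η ℚ.+ ½ ℚ.* ε))      <⟨ ℚₚ.+-monoʳ-< (seq r k) (ℚₚ.+-monoˡ-< (η ℚ.+ ½ ℚ.* ε) 0<η) ⟩
    seq r k ℚ.+ (η ℚ.+ (η ℚ.+ ½ ℚ.* ε))       ≡⟨ cong (seq r k ℚ.+_) (ℚₚ.+-assoc η η (½ ℚ.* ε)) ⟨
    seq r k ℚ.+ ((η ℚ.+ η) ℚ.+ ½ ℚ.* ε)       ≡⟨ cong (λ y → seq r k ℚ.+ (y ℚ.+ ½ ℚ.* ε)) (half+half (½ ℚ.* ε)) ⟩
    seq r k ℚ.+ (½ ℚ.* ε ℚ.+ ½ ℚ.* ε)         ≡⟨ cong (seq r k ℚ.+_) (half+half ε) ⟩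
    seq r k ℚ.+ ε                             ∎)
    where open ℚₚ.≤-Reasoning
  decide (no x≮) = inj₂ (N , η , 0<η , λ k k≥ → ℚₚ.≰⇒> λ x≤ → x≮ (begin-strict
    seq x N                                   <⟨ close-x ℕₚ.≤-refl k≥ ⟩
    seq x k ℚ.+ δ                             ≤⟨ ℚₚ.+-monoˡ-≤ δ x≤ ⟩
    (seq r k ℚ.+ η) ℚ.+ δ                     <⟨ ℚₚ.+-monoˡ-< δ (ℚₚ.+-monoˡ-< η (close-r k≥ ℕₚ.≤-refl)) ⟩
    ((seq r N ℚ.+ δ) ℚ.+ η) ℚ.+ δ             ≡⟨ solve 3 (λ a d e → ((a :+ d) :+ e) :+ d := a :+ ((d :+ d) :+ e)) refl (seq r N) δ η ⟩
    seq r N ℚ.+ ((δ ℚ.+ δ) ℚ.+ η)             ≡⟨ cong (λ y → seq r N ℚ.+ (y ℚ.+ η)) (half+half η) ⟩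
    seq r N ℚ.+ (η ℚ.+ η)                     ≡⟨ cong (seq r N ℚ.+_) (half+half (½ ℚ.* ε)) ⟩
    seq r N ℚ.+ ½ ℚ.* ε                       ∎))
    where open ℚₚ.≤-Reasoning

*-whenℚ : ∀ x y b → (x whenℚ b) ℚ.* y ≡ (x ℚ.* y whenℚ b)
*-whenℚ x y false = ℚₚ.*-zeroˡ y
*-whenℚ x y true  = refl

ι-if : ∀ b z → ι (if b then z else 0ℤ) ≡ (ι z whenℚ b)
ι-if false z = refl
ι-if true  z = refl

ι≡0⇒≡0 : ∀ n → ι (+ n) ≡ 0ℚ → n ≡ 0
ι≡0⇒≡0 zero    _    = refl
ι≡0⇒≡0 (suc n) ι≡0 = contradiction (sym ι≡0) (ℚₚ.<⇒≢ (ι-mono-< {0ℤ} {+ suc n} (ℤ.+<+ (ℕ.s≤s ℕ.z≤n))))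

null-const : ∀ {c} → Null (λ _ → c) → c ≡ 0ℚ
null-const {c} c→0 with c ℚ.≟ 0ℚ
... | yes c≡0 = c≡0
... | no c≢0  = contradiction (proj₂ bound (proj₁ bound) ℕₚ.≤-refl) (ℚₚ.<-irrefl refl)
  where
  0<∣c∣ : 0ℚ ℚ.< ℚ.∣ c ∣
  0<∣c∣ = ℚₚ.≰⇒> λ ∣c∣≤0 → c≢0 (ℚₚ.∣p∣≡0⇒p≡0 c (ℚₚ.≤-antisym ∣c∣≤0 (ℚₚ.0≤∣p∣ c)))
  bound = c→0 ℚ.∣ c ∣ 0<∣c∣

module ScalarSquare {N : ℕ} (A : Mat N) (n : ℕ) (A² : ∀ i j → (A *ᴹ A) i j ≡ scalar (+ n) i j) where

  M : Fin N → Fin N → ℚ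
  M i j = ι (A i j)

  _·_ : (Fin N → Fin N → ℚ) → (Fin N → ℚ) → Fin N → ℚ
  (B · x) i = sumℚ λ j → B i j ℚ.* x j

  seq-*ⱽ : ∀ v i k → seq ((toℝ A *ⱽℝ v) i) k ≡ (M · λ j → seq (v j) k) i
  seq-*ⱽ v i k = seq-sum (λ j → toℝ A i j * v j) k

  M²-entry : ∀ i l → sumℚ (λ j → M i j ℚ.* M j l) ≡ (ι (+ n) whenℚ does (i Fin.≟ l))
  M²-entry i l = trans (sumℚ-cong λ j → sym (ι-* (A i j) (A j l)))
    (trans (sym (ι-sum λ j → A i j ℤ.* A j l))
      (trans (cong ι (A² i l)) (ι-if (does (i Fin.≟ l)) (+ n))))

  M²-action : ∀ x i → (M · (M · x)) i ≡ ι (+ n) ℚ.* x i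
  M²-action x i = begin
    (sumℚ λ j → M i j ℚ.* (M · x) j)
      ≡⟨ sumℚ-cong (λ j → *-sumℚ (M i j) λ l → M j l ℚ.* x l) ⟩
    (sumℚ λ j → sumℚ λ l → M i j ℚ.* (M j l ℚ.* x l))
      ≡⟨ sumℚ-comm (λ j l → M i j ℚ.* (M j l ℚ.* x l)) ⟩
    (sumℚ λ l → sumℚ λ j → M i j ℚ.* (M j l ℚ.* x l))
      ≡⟨ sumℚ-cong column ⟩
    (sumℚ λ l → ι (+ n) ℚ.* x l whenℚ does (l Fin.≟ i))
      ≡⟨ sumℚ-δ (λ l → ι (+ n) ℚ.* x l) i ⟩
    ι (+ n) ℚ.* x i ∎
    where
    open ≡-Reasoning
    column : ∀ l → sumℚ (λ j → M i j ℚ.* (M j l ℚ.* x l)) ≡ (ι (+ n) ℚ.* x l whenℚ does (l Fin.≟ i))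
    column l = begin
      sumℚ (λ j → M i j ℚ.* (M j l ℚ.* x l))
        ≡⟨ sumℚ-cong (λ j → sym (ℚₚ.*-assoc (M i j) (M j l) (x l))) ⟩
      sumℚ (λ j → (M i j ℚ.* M j l) ℚ.* x l)
        ≡⟨ sym (sumℚ-* (x l) λ j → M i j ℚ.* M j l) ⟩
      sumℚ (λ j → M i j ℚ.* M j l) ℚ.* x l
        ≡⟨ cong (ℚ._* x l) (M²-entry i l) ⟩
      (ι (+ n) whenℚ does (i Fin.≟ l)) ℚ.* x l
        ≡⟨ *-whenℚ (ι (+ n)) (x l) (does (i Fin.≟ l)) ⟩
      (ι (+ n) ℚ.* x l whenℚ does (i Fin.≟ l))
        ≡⟨ cong (ι (+ n) ℚ.* x l whenℚ_) (does-sym i l) ⟩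
      (ι (+ n) ℚ.* x l whenℚ does (l Fin.≟ i)) ∎

  ·-linear : ∀ x y c i → (M · λ j → x j ℚ.+ c ℚ.* y j) i ≡ (M · x) i ℚ.+ c ℚ.* (M · y) i
  ·-linear x y c i = begin
    (sumℚ λ j → M i j ℚ.* (x j ℚ.+ c ℚ.* y j))
      ≡⟨ sumℚ-cong (λ j → solve 4 (λ m x c y → m :* (x :+ c :* y) := m :* x :+ c :* (m :* y)) refl (M i j) (x j) c (y j)) ⟩
    (sumℚ λ j → M i j ℚ.* x j ℚ.+ c ℚ.* (M i j ℚ.* y j))
      ≡⟨ sumℚ-+ (λ j → M i j ℚ.* x j) (λ j → c ℚ.* (M i j ℚ.* y j)) ⟩
    (M · x) i ℚ.+ (sumℚ λ j → c ℚ.* (M i j ℚ.* y j))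
      ≡⟨ cong (ℚ._+_ ((M · x) i)) (sym (*-sumℚ c λ j → M i j ℚ.* y j)) ⟩
    (M · x) i ℚ.+ c ℚ.* (M · y) i ∎
    where
    open ≡-Reasoning
    open +-*-Solver

  -- This is (M + m)(M - m) = n - m² applied to `x`, exact for every rational m. It expresses (n -
  -- m²)x through the failure of `x` to be an eigenvector for m, and is used at each index with m
  -- the term of μ.
  residual : ∀ x m i →
    (M · λ j → (M · x) j ℚ.- m ℚ.* x j) i ℚ.+ m ℚ.* ((M · x) i ℚ.- m ℚ.* x i) ≡ (ι (+ n) ℚ.- m ℚ.* m) ℚ.* x i
  residual x m i = begin
    (M · λ j → (M · x) j ℚ.- m ℚ.* x j) i ℚ.+ m ℚ.* (y ℚ.- m ℚ.* x i)
      -- Moving the minus sign onto m gives the shape x + c y of `·-linear` with c = -m.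
      ≡⟨ cong (ℚ._+ m ℚ.* (y ℚ.- m ℚ.* x i)) (trans
           (sumℚ-cong λ j → cong (λ z → M i j ℚ.* ((M · x) j ℚ.+ z)) (ℚₚ.neg-distribˡ-* m (x j)))
           (·-linear (M · x) x (ℚ.- m) i)) ⟩
    ((M · (M · x)) i ℚ.+ (ℚ.- m) ℚ.* y) ℚ.+ m ℚ.* (y ℚ.- m ℚ.* x i)
      ≡⟨ cong (λ z → (z ℚ.+ (ℚ.- m) ℚ.* y) ℚ.+ m ℚ.* (y ℚ.- m ℚ.* x i)) (M²-action x i) ⟩
    (ι (+ n) ℚ.* x i ℚ.+ (ℚ.- m) ℚ.* y) ℚ.+ m ℚ.* (y ℚ.- m ℚ.* x i)
      ≡⟨ solve 4 (λ c x m y → (c :* x :+ (:- m) :* y) :+ m :* (y :- m :* x) := (c :- m :* m) :* x) refl (ι (+ n)) (x i) m y ⟩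
    (ι (+ n) ℚ.- m ℚ.* m) ℚ.* x i ∎
    where
    open ≡-Reasoning
    open +-*-Solver
    y : ℚ
    y = (M · x) i

  eigenvalue-null : ∀ μ (v : Fin N → ℝ) → (∀ i → (toℝ A *ⱽℝ v) i ≈ μ * v i) →
    ∀ i → Null (λ k → (ι (+ n) ℚ.- seq μ k ℚ.* seq μ k) ℚ.* seq (v i) k)
  eigenvalue-null μ v eigen i = null-resp (λ k → residual (λ j → seq (v j) k) (seq μ k) i)
    (null-+ (null-sum (λ j k → M i j ℚ.* defect j k) (λ j → null-* (fromℤ (A i j)) (defect-null j)))
            (null-* μ (defect-null i)))
    where
    defect : Fin N → ℕ → ℚ
    defect j k = (M · λ l → seq (v l) k) j ℚ.- seq μ k ℚ.* seq (v j) k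
    defect-null : ∀ j → Null (defect j)
    defect-null j = null-resp (λ k → cong (ℚ._- seq μ k ℚ.* seq (v j) k) (seq-*ⱽ v j k)) (eigen j)

  open SquareRoot n

  module _ (μ : ℝ) (v : Fin N → ℝ) (eigen : ∀ i → (toℝ A *ⱽℝ v) i ≈ μ * v i) {K η} (0<η : 0ℚ ℚ.< η)
           (apart : ∀ k → K ℕ.≤ k → approx k ℚ.+ η ℚ.< ℚ.∣ seq μ k ∣) where
    open +-*-Solver

    -- Measured from `approx k`² rather than from n, because `apart` compares with `approx k` at
    -- each index; by `√-square` the replacement costs only a null term.
    gap : ℕ → ℚ
    gap k = seq μ k ℚ.* seq μ k ℚ.- approx k ℚ.* approx k

    η²≤gap : ∀ k → K ℕ.≤ k → η ℚ.* η ℚ.≤ gap k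
    η²≤gap k k≥ = begin
      η ℚ.* η
        ≡⟨ ℚₚ.+-identityʳ (η ℚ.* η) ⟨
      η ℚ.* η ℚ.+ 0ℚ
        ≤⟨ ℚₚ.+-monoʳ-≤ (η ℚ.* η) (*-0≤ {η} {a ℚ.+ a} (ℚₚ.<⇒≤ 0<η) (ℚₚ.+-mono-≤ (0≤approx k) (0≤approx k))) ⟩
      η ℚ.* η ℚ.+ η ℚ.* (a ℚ.+ a)
        ≡⟨ solve 2 (λ e a → e :* e :+ e :* (a :+ a) := (a :+ e) :* (a :+ e) :- a :* a) refl η a ⟩
      (a ℚ.+ η) ℚ.* (a ℚ.+ η) ℚ.- a ℚ.* a
        ≤⟨ ℚₚ.+-monoˡ-≤ (ℚ.- (a ℚ.* a)) (square-mono-≤ (ℚₚ.+-mono-≤ (0≤approx k) (ℚₚ.<⇒≤ 0<η)) (ℚₚ.<⇒≤ (apart k k≥))) ⟩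
      ℚ.∣ seq μ k ∣ ℚ.* ℚ.∣ seq μ k ∣ ℚ.- a ℚ.* a
        ≡⟨ cong (ℚ._- a ℚ.* a) (∣p∣²≡p² (seq μ k)) ⟩
      gap k ∎
      where
      open ℚₚ.≤-Reasoning
      a : ℚ
      a = approx k

    gap-v-null : ∀ i → Null (λ k → gap k ℚ.* seq (v i) k)
    gap-v-null i = null-resp
      (λ k → solve 4 (λ x c m a → x :* (c :- a) :+ (:- con 1ℚ) :* ((c :- m) :* x) := (m :- a) :* x) refl
        (seq (v i) k) (ι (+ n)) (seq μ k ℚ.* seq μ k) (approx k ℚ.* approx k))
      (null-+ (null-* (v i) √-square) (null-* (fromℤ ℤ.-1ℤ) (eigenvalue-null μ v eigen i)))

    apart⇒null : ∀ i → v i ≈ fromℤ 0ℤ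
    apart⇒null i = null-resp (λ k → sym (ℚₚ.+-identityʳ (seq (v i) k)))
      (null-cancel {g = λ k → gap k ℚ.* seq (v i) k} (η ℚ.* η) (ℚₚ.positive⁻¹ (η ℚ.* η) {{ℚₚ.pos*pos⇒pos η {{ℚ.positive 0<η}} η {{ℚ.positive 0<η}}}})
        (K , λ k k≥ → ℚₚ.≤-trans
          (ℚₚ.*-monoʳ-≤-nonNeg ℚ.∣ seq (v i) k ∣ {{ℚₚ.∣-∣-nonNeg (seq (v i) k)}} (ℚₚ.≤-trans (η²≤gap k k≥) (p≤∣p∣ (gap k))))
          (ℚₚ.≤-reflexive (sym (ℚₚ.∣p*q∣≡∣p∣*∣q∣ (gap k) (seq (v i) k)))))
        (gap-v-null i))

  eigenvalue-≤-√ : ∀ μ → IsEigenvalue (toℝ A) μ → ∣ μ ∣ ≤ √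
  eigenvalue-≤-√ μ (v , v≉0 , eigen) ε 0<ε = bounded (eventually-<+ε⊎apart ∣ μ ∣ √ ε 0<ε)
    where
    bounded : _ → ∃[ K ] (∀ k → K ℕ.≤ k → ℚ.∣ seq μ k ∣ ℚ.< approx k ℚ.+ ε)
    bounded (inj₁ eventually-<)          = eventually-<
    bounded (inj₂ (K , η , 0<η , apart)) = ⊥-elim (v≉0 (apart⇒null μ v eigen 0<η apart))

  ∣√∣≈√ : ∣ √ ∣ ≈ √
  ∣√∣≈√ = null-resp (λ k → sym (trans (cong (ℚ._- approx k) (ℚₚ.0≤p⇒∣p∣≡p (0≤approx k))) (ℚₚ.+-inverseʳ (approx k)))) null-0

  e : Fin N → Fin N → ℤ
  e o j = if does (j Fin.≟ o) then 1ℤ else 0ℤ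

  unit : Fin N → Fin N → ℝ
  unit o j = fromℤ (e o j)

  eigenvector : Fin N → Fin N → ℝ
  eigenvector o j = fromℤ (A j o) + √ * unit o j

  ·-e : ∀ o i → (M · λ j → ι (e o j)) i ≡ M i o
  ·-e o i = trans (sumℚ-cong λ j → trans (ℚₚ.*-comm (M i j) (ι (e o j)))
      (trans (cong (ℚ._* M i j) (ι-if (does (j Fin.≟ o)) 1ℤ))
        (trans (*-whenℚ 1ℚ (M i j) (does (j Fin.≟ o))) (cong (_whenℚ does (j Fin.≟ o)) (ℚₚ.*-identityˡ (M i j))))))
    (sumℚ-δ (M i) o)

  -- Column `o` of `M` is the image of a basis vector, so this is M² acting on that vector.
  ·-column : ∀ o i → (M · λ j → M j o) i ≡ ι (+ n) ℚ.* ι (e o i)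
  ·-column o i = trans (sumℚ-cong λ j → cong (M i j ℚ.*_) (sym (·-e o j))) (M²-action (λ j → ι (e o j)) i)

  -- With a = `approx k` the defect at index k is (M - a)(M + a)e = (n - a²)e, which is null by
  -- `√-square`.
  eigenvector-eigen : ∀ o i → (toℝ A *ⱽℝ eigenvector o) i ≈ √ * eigenvector o i
  eigenvector-eigen o i = null-resp (λ k → sym (defect k)) (null-* (unit o i) √-square)
    where
    open ≡-Reasoning
    open +-*-Solver
    defect : ∀ k → seq ((toℝ A *ⱽℝ eigenvector o) i) k ℚ.- approx k ℚ.* (M i o ℚ.+ approx k ℚ.* ι (e o i))
      ≡ ι (e o i) ℚ.* (ι (+ n) ℚ.- approx k ℚ.* approx k)
    defect k = begin
      seq ((toℝ A *ⱽℝ eigenvector o) i) k ℚ.- a ℚ.* (M i o ℚ.+ a ℚ.* ι (e o i))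
        ≡⟨ cong (ℚ._- a ℚ.* (M i o ℚ.+ a ℚ.* ι (e o i))) (trans (seq-*ⱽ (eigenvector o) i k)
             (trans (·-linear (λ j → M j o) (λ j → ι (e o j)) a i)
               (cong₂ (λ x y → x ℚ.+ a ℚ.* y) (·-column o i) (·-e o i)))) ⟩
      (ι (+ n) ℚ.* ι (e o i) ℚ.+ a ℚ.* M i o) ℚ.- a ℚ.* (M i o ℚ.+ a ℚ.* ι (e o i))
        ≡⟨ solve 4 (λ c d a m → (c :* d :+ a :* m) :- a :* (m :+ a :* d) := d :* (c :- a :* a)) refl
             (ι (+ n)) (ι (e o i)) a (M i o) ⟩
      ι (e o i) ℚ.* (ι (+ n) ℚ.- a ℚ.* a) ∎
      where
      a : ℚ
      a = approx k

  -- The zero diagonal leaves √n as entry `o`. Were it null, so would be its square, which is n up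
  -- to a null term; but a constant null sequence is 0.
  eigenvector-≉0 : ∀ o → A o o ≡ 0ℤ → n ≢ 0 → ¬ (∀ i → eigenvector o i ≈ fromℤ 0ℤ)
  eigenvector-≉0 o Aoo≡0 n≢0 v≈0 = n≢0 (ι≡0⇒≡0 n (null-const n-null))
    where
    open +-*-Solver
    entry : ∀ k → seq (eigenvector o o) k ℚ.- 0ℚ ≡ approx k
    entry k = trans (cong₂ (λ x b → (ι x ℚ.+ approx k ℚ.* ι (if b then 1ℤ else 0ℤ)) ℚ.- 0ℚ) Aoo≡0 (dec-true (o Fin.≟ o) refl))
      (solve 1 (λ a → (con 0ℚ :+ a :* con 1ℚ) :- con 0ℚ := a) refl (approx k))

    n-null : Null (λ _ → ι (+ n))
    n-null = null-resp (λ k → solve 2 (λ c a → (c :- a :* a) :+ a :* a := c) refl (ι (+ n)) (approx k))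
      (null-+ √-square (null-* √ (null-resp entry (v≈0 o))))

  √-spectralRadius : n ≢ 0 → ∀ o → A o o ≡ 0ℤ → IsSpectralRadius (toℝ A) √
  √-spectralRadius n≢0 o Aoo≡0 =
    (√ , (eigenvector o , eigenvector-≉0 o Aoo≡0 n≢0 , eigenvector-eigen o) , ∣√∣≈√) , eigenvalue-≤-√

  -- Serves n = 0: here (A + √n)e vanishes, but e itself lies in the kernel of A, and √n is 0.
  √-spectralRadius-null : Null approx → ∀ o → (∀ i → A i o ≡ 0ℤ) → IsSpectralRadius (toℝ A) √
  √-spectralRadius-null approx-null o column≡0 =
    (√ , (unit o , nonzero , eigen) , ∣√∣≈√) , eigenvalue-≤-√
    where
    nonzero : ¬ (∀ i → unit o i ≈ fromℤ 0ℤ)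
    nonzero e≈0 = ℚₚ.1≢0 (null-const (null-resp
      (λ _ → cong (λ b → ι (if b then 1ℤ else 0ℤ) ℚ.- 0ℚ) (dec-true (o Fin.≟ o) refl)) (e≈0 o)))
    eigen : ∀ i → (toℝ A *ⱽℝ unit o) i ≈ √ * unit o i
    eigen i = null-resp (λ k → sym (defect k)) (null-* (- unit o i) approx-null)
      where
      open ≡-Reasoning
      open +-*-Solver
      image≡0 : ∀ k → seq ((toℝ A *ⱽℝ unit o) i) k ≡ 0ℚ
      image≡0 k = trans (seq-*ⱽ (unit o) i k) (trans (·-e o i) (cong ι (column≡0 i)))
      defect : ∀ k → seq ((toℝ A *ⱽℝ unit o) i) k ℚ.- approx k ℚ.* ι (e o i) ≡ (ℚ.- ι (e o i)) ℚ.* approx k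
      defect k = begin
        seq ((toℝ A *ⱽℝ unit o) i) k ℚ.- approx k ℚ.* ι (e o i)
          ≡⟨ cong (ℚ._- approx k ℚ.* ι (e o i)) (image≡0 k) ⟩
        0ℚ ℚ.- approx k ℚ.* ι (e o i)
          ≡⟨ ℚₚ.+-identityˡ (ℚ.- (approx k ℚ.* ι (e o i))) ⟩
        ℚ.- (approx k ℚ.* ι (e o i))
          ≡⟨ solve 2 (λ a d → :- (a :* d) := (:- d) :* a) refl (approx k) (ι (e o i)) ⟩
        (ℚ.- ι (e o i)) ℚ.* approx k ∎

proposition5 : (n : ℕ) →
    (∃[ s ] All4CyclesUnbalanced (Q n) s)
    × ((s : EdgeVector (Q n)) → All4CyclesUnbalanced (Q n) s →
    let A = signedAdjacency (Q n) s in
    (∀ u v → (A *ᴹ A) u v ≡ scalar (+ n) u v)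
    × (∃[ r ] (IsSqrt r n × IsSpectralRadius (toℝ A) r)))
proposition5 n = (paritySigning , paritySigning-unbalanced) , λ s unbalanced →
    SignedHypercube.square-scalar n s unbalanced
  , SquareRoot.√ n , SquareRoot.√-isSqrt n , spectralRadius n s unbalanced
  where
  open Hypercube n
  origin : ∀ n → Vertex (Q n)
  origin n = Fin.funToFin {n} λ _ → zero
  A : ∀ n → EdgeVector (Q n) → Mat (2 ℕ.^ n)
  A n s = signedAdjacency (Q n) s
  A-diagonal : ∀ n s u → A n s u u ≡ 0ℤ
  A-diagonal n s u = signedAdjacency-nonadjacent (Q n) s {u} (Graph.irrefl (Q n) {u} refl)
  spectralRadius : ∀ n s → All4CyclesUnbalanced (Q n) s → IsSpectralRadius (toℝ (A n s)) (SquareRoot.√ n)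
  -- `Q 0` has a single vertex, so the diagonal is the whole matrix; the integer root of 0 is 0, so
  -- `approx k` reduces to 0 times `1/suc k`.
  spectralRadius zero s unbalanced = √-spectralRadius-null
    (null-resp (λ k → sym (ℚₚ.*-zeroˡ (1/suc k))) null-0) zero λ { zero → A-diagonal 0 s zero }
    where open ScalarSquare (A 0 s) 0 (SignedHypercube.square-scalar 0 s unbalanced)
  spectralRadius (suc n) s unbalanced = √-spectralRadius (λ ()) (origin (suc n)) (A-diagonal (suc n) s (origin (suc n)))
    where open ScalarSquare (A (suc n) s) (suc n) (SignedHypercube.square-scalar (suc n) s unbalanced)
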